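{- Let $n,q$ be positive integers with $n$ even, $n\ge8$, $q\ge2$. Any $7$-design $C$ in $H(n,q)$ with degree $4$ and degree set $\{a,n/2,n-a,n\}$ for some integer $a$ with $a<n/2$ is isomorphic either to the dual of the binary repetition code of length $8$ (the set of all binary vectors of length $8$ of even weight) or to the extended binary Golay code of length $24$.
   Context: $[q]=\{1,\ldots,q\}$; $\partial$ is Hamming distance. A nonempty $C\subseteq[q]^n$ is a $t$-design in the Hamming scheme $H(n,q)$ if the array of its elements (as rows) is an orthogonal array of strength $t$: in any $t$ columns every element of $[q]^t$ occurs equally often. Its degree set is $\{\partial(x,y):x,y\in C,x\ne y\}$ and its degree is the size of that set. Two codes are isomorphic if one is obtained from the other by permuting coordinates and permuting symbols within each coordinate. -}

module Defs where

open import Data.Nat using (ℕ; zero; suc; _+_; _%_)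
open import Data.Fin using (Fin; zero; suc; _≟_)
open import Data.Vec using (Vec; []; _∷_; lookup; tabulate; replicate; zipWith; foldr)
open import Data.Vec.Properties using (≡-dec)
open import Data.List using (List; length; filter)
open import Data.List.Membership.Propositional using (_∈_)
open import Data.List.Relation.Unary.Unique.Propositional using (Unique)
open import Data.Product using (Σ; ∃; ∃-syntax; _×_)
open import Function.Bundles using (_↔_; Inverse; _⇔_)
open import Function.Definitions using (Injective)
open import Relation.Binary.PropositionalEquality using (_≡_; _≢_)
open import Relation.Nullary using (yes; no)

Word : ℕ → ℕ → Set
Word n q = Vec (Fin q) n

record Code (n q : ℕ) : Set where
  field
    words  : List (Word n q)
    unique : Unique words
open Code public

_∈C_ : ∀ {n q} → Word n q → Code n q → Set
x ∈C C = x ∈ words C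

Nonempty : ∀ {n q} → Code n q → Set
Nonempty C = ∃[ x ] (x ∈C C)

dist : ∀ {n q} → Word n q → Word n q → ℕ
dist [] [] = 0
dist (a ∷ x) (b ∷ y) with a ≟ b
... | yes _ = dist x y
... | no  _ = suc (dist x y)

restrict : ∀ {n q t} → (Fin t → Fin n) → Word n q → Vec (Fin q) t
restrict cols c = tabulate (λ i → lookup c (cols i))

occ : ∀ {n q t} → Code n q → (Fin t → Fin n) → Vec (Fin q) t → ℕ
occ C cols u = length (filter (λ c → ≡-dec _≟_ (restrict cols c) u) (words C))

-- t-design in H(n,q): the codewords, as rows of an array, form an
-- orthogonal array of strength t: in any t (distinct) columns every
-- element of [q]^t occurs equally often.
IsDesign : ∀ {n q} → ℕ → Code n q → Set
IsDesign {n} {q} t C =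
  Nonempty C ×
  ((cols : Fin t → Fin n) → Injective _≡_ _≡_ cols →
   (u v : Vec (Fin q) t) → occ C cols u ≡ occ C cols v)

InDegreeSet : ∀ {n q} → Code n q → ℕ → Set
InDegreeSet C d = ∃[ x ] ∃[ y ] (x ∈C C × y ∈C C × x ≢ y × dist x y ≡ d)

isoMap : ∀ {n q n' q'} → (σ : Fin n' ↔ Fin n) → (π : Fin n' → Fin q ↔ Fin q') →
         Word n q → Word n' q'
isoMap σ π x = tabulate (λ j → Inverse.to (π j) (lookup x (Inverse.to σ j)))

IsomorphicTo : ∀ {n q n' q'} → Code n q → (Word n' q' → Set) → Set
IsomorphicTo {n} {q} {n'} {q'} C D =
  Σ (Fin n' ↔ Fin n) λ σ → Σ (Fin n' → Fin q ↔ Fin q') λ π →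
    (x : Word n q) → (x ∈C C) ⇔ D (isoMap σ π x)

o l : Fin 2
o = zero
l = suc zero

weight : ∀ {n} → Word n 2 → ℕ
weight x = dist x (replicate _ o)

EvenWeight8 : Word 8 2 → Set
EvenWeight8 x = weight x % 2 ≡ 0

_⊕_ : Fin 2 → Fin 2 → Fin 2
zero ⊕ b = b
suc zero ⊕ zero = suc zero
suc zero ⊕ suc zero = zero

-- Generator matrix of the extended binary Golay code: the 12 cyclic
-- shifts of g(x) = 1+x^2+x^4+x^5+x^6+x^10+x^11 (binary Golay code of
-- length 23), each extended by an overall parity bit.
golayRows : Vec (Vec (Fin 2) 24) 12
golayRows =
    (l ∷ o ∷ l ∷ o ∷ l ∷ l ∷ l ∷ o ∷ o ∷ o ∷ l ∷ l ∷ o ∷ o ∷ o ∷ o ∷ o ∷ o ∷ o ∷ o ∷ o ∷ o ∷ o ∷ l ∷ [])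
  ∷ (o ∷ l ∷ o ∷ l ∷ o ∷ l ∷ l ∷ l ∷ o ∷ o ∷ o ∷ l ∷ l ∷ o ∷ o ∷ o ∷ o ∷ o ∷ o ∷ o ∷ o ∷ o ∷ o ∷ l ∷ [])
  ∷ (o ∷ o ∷ l ∷ o ∷ l ∷ o ∷ l ∷ l ∷ l ∷ o ∷ o ∷ o ∷ l ∷ l ∷ o ∷ o ∷ o ∷ o ∷ o ∷ o ∷ o ∷ o ∷ o ∷ l ∷ [])
  ∷ (o ∷ o ∷ o ∷ l ∷ o ∷ l ∷ o ∷ l ∷ l ∷ l ∷ o ∷ o ∷ o ∷ l ∷ l ∷ o ∷ o ∷ o ∷ o ∷ o ∷ o ∷ o ∷ o ∷ l ∷ [])
  ∷ (o ∷ o ∷ o ∷ o ∷ l ∷ o ∷ l ∷ o ∷ l ∷ l ∷ l ∷ o ∷ o ∷ o ∷ l ∷ l ∷ o ∷ o ∷ o ∷ o ∷ o ∷ o ∷ o ∷ l ∷ [])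
  ∷ (o ∷ o ∷ o ∷ o ∷ o ∷ l ∷ o ∷ l ∷ o ∷ l ∷ l ∷ l ∷ o ∷ o ∷ o ∷ l ∷ l ∷ o ∷ o ∷ o ∷ o ∷ o ∷ o ∷ l ∷ [])
  ∷ (o ∷ o ∷ o ∷ o ∷ o ∷ o ∷ l ∷ o ∷ l ∷ o ∷ l ∷ l ∷ l ∷ o ∷ o ∷ o ∷ l ∷ l ∷ o ∷ o ∷ o ∷ o ∷ o ∷ l ∷ [])
  ∷ (o ∷ o ∷ o ∷ o ∷ o ∷ o ∷ o ∷ l ∷ o ∷ l ∷ o ∷ l ∷ l ∷ l ∷ o ∷ o ∷ o ∷ l ∷ l ∷ o ∷ o ∷ o ∷ o ∷ l ∷ [])
  ∷ (o ∷ o ∷ o ∷ o ∷ o ∷ o ∷ o ∷ o ∷ l ∷ o ∷ l ∷ o ∷ l ∷ l ∷ l ∷ o ∷ o ∷ o ∷ l ∷ l ∷ o ∷ o ∷ o ∷ l ∷ [])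
  ∷ (o ∷ o ∷ o ∷ o ∷ o ∷ o ∷ o ∷ o ∷ o ∷ l ∷ o ∷ l ∷ o ∷ l ∷ l ∷ l ∷ o ∷ o ∷ o ∷ l ∷ l ∷ o ∷ o ∷ l ∷ [])
  ∷ (o ∷ o ∷ o ∷ o ∷ o ∷ o ∷ o ∷ o ∷ o ∷ o ∷ l ∷ o ∷ l ∷ o ∷ l ∷ l ∷ l ∷ o ∷ o ∷ o ∷ l ∷ l ∷ o ∷ l ∷ [])
  ∷ (o ∷ o ∷ o ∷ o ∷ o ∷ o ∷ o ∷ o ∷ o ∷ o ∷ o ∷ l ∷ o ∷ l ∷ o ∷ l ∷ l ∷ l ∷ o ∷ o ∷ o ∷ l ∷ l ∷ l ∷ [])
  ∷ []

encode : ∀ {k n} → Vec (Fin 2) k → Vec (Vec (Fin 2) n) k → Vec (Fin 2) n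
encode [] [] = replicate _ o
encode (zero ∷ m) (r ∷ rs) = encode m rs
encode (suc _ ∷ m) (r ∷ rs) = zipWith _⊕_ r (encode m rs)

Golay24 : Word 24 2 → Set
Golay24 x = ∃[ m ] (x ≡ encode m golayRows)

{-# OPTIONS --safe #-}
-- Count agreements z with a fixed codeword. The strength gives the factorial moments of z up to order 7,
-- also inside the subcode disagreeing with that codeword on up to three given coordinates. There the quartic with
-- roots 0, a, n/2, n - a sums to zero; comparing one, two and three coordinates forces q = 2 and
-- 3n = (n - 2a)² + 8, and the whole code yields |C|. Integrality of the number of words at distance a then
-- leaves (n, a) = (8, 2) and (24, 8).
--
-- For n = 8 all distances are even and every 7-tuple occurs, so C is a translate of the even weight code.
-- For n = 24 translate so that 0 ∈ C. All distances are divisible by 4, and the sextic with roots 0, 4, …, 20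
-- shows that a word at distances divisible by 4 from all of C belongs to C; hence C is linear. A quadratic moment
-- gives an octad through any five points. The rows of the generator matrix are then found one after the other as
-- octads through five points: up to permutations fixing the earlier rows there is a single possibility each time,
-- which is checked by evaluation. Self-duality of the Golay code gives equality.
module Submission where

open import Defs
open import Data.Bool using (Bool; true; false; _∧_; _∨_; not; if_then_else_)
open import Data.Bool.ListAction using (any; all)
open import Data.Bool.Properties using (∧-conicalˡ; ∧-conicalʳ)
open import Data.Empty using (⊥-elim)
open import Data.Fin using (Fin; zero; suc; toℕ; fromℕ<; #_; _≟_)
open import Data.Fin.Properties using (all?; suc-injective)
open import Data.Integer using (ℤ; +_; _+_; _*_; _-_; -_; 0ℤ; 1ℤ; _^_; ∣_∣)
open import Data.Integer.Properties using (*-zeroʳ; *-zeroˡ; +-identityʳ; +-identityˡ; *-identityˡ; *-identityʳ; *-comm; *-distribˡ-+; +-injective; i*j≡0⇒i≡0∨j≡0; i^n≡0⇒i≡0; pos-+; i-j≡0⇒i≡j; i≡j⇒i-j≡0; abs-*)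
open import Data.Integer.Tactic.RingSolver using (solve-∀)
open import Data.List using (List; []; _∷_; _++_; map; foldr; length; filter; allFin)
import Data.List as List
open import Data.List.Membership.Propositional using (_∈_; find)
import Data.List.Membership.DecPropositional as DecMembership
open import Data.List.Membership.Propositional.Properties using (∈-∃++; ∈-allFin)
open import Data.List.Properties using (length-++; length-tabulate)
open import Data.List.Relation.Binary.Permutation.Propositional as ↭ using (_↭_; ↭-sym; ↭⇒↭ₛ)
open import Data.List.Relation.Binary.Permutation.Propositional.Properties using (shift; ∈-resp-↭; ↭-length)
import Data.List.Relation.Binary.Permutation.Setoid.Properties as Setoid↭
open import Data.List.Relation.Unary.All using (All; []; _∷_)
import Data.List.Relation.Unary.All as All
import Data.List.Relation.Unary.All.Properties as All
open import Data.List.Relation.Unary.AllPairs using ([]; _∷_)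
open import Data.List.Relation.Unary.Any using (here; there; any?)
import Data.List.Relation.Unary.Any as Any
open import Data.List.Relation.Unary.Unique.DecPropositional using (unique?)
open import Data.List.Relation.Unary.Unique.Propositional using (Unique)
open import Data.List.Relation.Unary.Unique.Propositional.Properties using (allFin⁺; map⁺)
open import Data.Nat using (ℕ; zero; suc; _≤_; _<_; _∸_; _/_; _%_; s≤s; z≤n)
import Data.Nat as ℕ
import Data.Nat.Divisibility as ℕ
open import Data.Nat.DivMod using (m≡m%n+[m/n]*n)
import Data.Nat.Properties as ℕ
import Data.Nat.Tactic.RingSolver as ℕ-Solver
open import Data.Product using (Σ; ∃-syntax; _×_; _,_; proj₁; proj₂)
open import Data.Sum using (_⊎_; inj₁; inj₂)
open import Data.Vec using (Vec; []; _∷_; lookup; tabulate; replicate; toList; zipWith)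
import Data.Vec as Vec
open import Data.Vec.Properties using (≡-dec; length-toList; lookup-allFin; lookup-map; lookup-replicate; lookup-zipWith; lookup∘tabulate; tabulate-cong; tabulate∘lookup; take++drop≡id; take-zipWith; toList-map; zipWith-assoc; zipWith-comm; zipWith-identityˡ; zipWith-identityʳ)
import Data.Vec.Relation.Unary.All as VAll
open import Function using (_∘_)
open import Function.Bundles using (_↔_; Inverse; mk↔ₛ′; _⇔_; mk⇔; Equivalence)
open import Function.Construct.Composition using (_↔-∘_)
open import Function.Construct.Identity using (↔-id)
open import Function.Construct.Symmetry using (↔-sym)
open import Function.Definitions using (Injective)
open import Relation.Binary.PropositionalEquality as ≡ using (_≡_; _≢_; refl; sym; trans; cong; cong₂; subst; module ≡-Reasoning)
open import Relation.Nullary using (Dec; yes; no; does)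
open import Relation.Nullary.Decidable using (from-no; from-yes; _×-dec_; _→-dec_)
open import Algebra.Properties.CommutativeMonoid.Sum ℕ.+-0-commutativeMonoid using (sum; sum-permute; sum-cong-≗)

open Inverse using (to; from; strictlyInverseˡ; strictlyInverseʳ)

-- Codes with the weights and octads of the extended Golay code

wt : ∀ {n} → Word n 2 → ℕ
wt []      = 0
wt (b ∷ x) = toℕ b ℕ.+ wt x

𝟎 : ∀ {n} → Word n 2
𝟎 = replicate _ o

infixl 6 _⊞_
_⊞_ : ∀ {n} → Word n 2 → Word n 2 → Word n 2
_⊞_ = zipWith _⊕_

okWeight : ℕ → Bool
okWeight w = (w ℕ.≡ᵇ 0) ∨ (w ℕ.≡ᵇ 8) ∨ (w ℕ.≡ᵇ 12) ∨ (w ℕ.≡ᵇ 16) ∨ (w ℕ.≡ᵇ 24)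

-- The weight still to be placed is an argument, so branches that would exceed it are cut. With five
-- points prescribed in length 24, weight 8 leaves 969 words to test, few enough for evaluation.
forallAbove : ∀ {n} → Word n 2 → ℕ → (Word n 2 → Bool) → Bool
forallAbove []           zero    t = t []
forallAbove []           (suc _) t = true
forallAbove (zero ∷ p)   zero    t = forallAbove p 0 (λ x → t (zero ∷ x))
forallAbove (zero ∷ p)   (suc k) t = forallAbove p k (λ x → t (l ∷ x)) ∧ forallAbove p (suc k) (λ x → t (o ∷ x))
forallAbove (suc _ ∷ p)  zero    t = true
forallAbove (suc _ ∷ p)  (suc k) t = forallAbove p k (λ x → t (l ∷ x))

-- Each column is packed into a number, the first word giving the lowest bit. A permutation of the
-- coordinates takes one list of words to another of the same length, word by word, exactly when the
-- two results agree as multisets.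
columns : ∀ {n} → List (Word n 2) → Vec ℕ n
columns = foldr (zipWith (λ b c → toℕ b ℕ.+ 2 ℕ.* c)) (replicate _ 0)

-- The continuation receives the chosen value and the remaining entries. If the key is missing it
-- receives the default; nothing is proved about the choice, since `isPermTaking` checks the
-- outcome.
pick : ∀ {A B : Set} → A → ℕ → List (ℕ × A) → (A → List (ℕ × A) → B) → B
pick d c []             k = k d []
pick d c ((e , a) ∷ xs) k = if c ℕ.≡ᵇ e then k a xs else pick d c xs (λ b ys → k b ((e , a) ∷ ys))

assign : ∀ {A : Set} {n} → A → Vec ℕ n → List (ℕ × A) → Vec A n
assign d []       _  = []
assign d (c ∷ cs) xs = pick d c xs (λ a ys → a ∷ assign d cs ys)

-- The k-th occurrence of a value in cs is paired with its k-th occurrence in ds, so matching ds cs is the inverse.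
matching : ∀ {m} → let n = suc m in Vec ℕ n → Vec ℕ n → Vec (Fin n) n
matching cs ds = assign zero cs (Vec.toList (Vec.zip ds (Vec.allFin _)))

isPermTaking : ∀ {n} → Vec (Fin n) n → Vec (Fin n) n → List (Word n 2) → Word n 2 → Word n 2 → Bool
isPermTaking ρ π K r w =
  does (≡-dec _≟_ (Vec.map (lookup ρ) π) (Vec.allFin _)) ∧
  does (≡-dec _≟_ (Vec.map (lookup π) ρ) (Vec.allFin _)) ∧
  does (≡-dec _≟_ (Vec.map (lookup r) ρ) w) ∧
  all (λ k → does (≡-dec _≟_ (Vec.map (lookup k) ρ) k)) K

movable : ∀ {m} → let n = suc m in Vec ℕ n → Vec ℕ n → List (Word n 2) → Word n 2 → Word n 2 → Bool
movable cs ds K r w = isPermTaking (matching cs ds) (matching ds cs) K r w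

incompatible : ∀ {n} → List (Word n 2) → Word n 2 → Bool
incompatible S w = any (λ s → not (okWeight (wt (w ⊞ s)))) S

-- Every octad through the five points of p that is compatible with the words S can be moved
-- onto r by a permutation of the coordinates fixing the words K.
forced : ∀ {m} → let n = suc m in List (Word n 2) → List (Word n 2) → Word n 2 → Word n 2 → Bool
forced K S p r = forallAbove p 8 (λ w →
  incompatible S w ∨ movable (columns (w ∷ K)) (columns (r ∷ K)) K r w)

-- The list `S` doubles with each row. Started from the zero word, it runs through the whole span of
-- the rows placed so far, and each candidate for the next row is tested against all of it.
chain : ∀ {m} → let n = suc m in List (Word n 2) → List (Word n 2) → List (Word n 2 × Word n 2) → Bool
chain K S []             = true
chain K S ((p , r) ∷ ps) = forced K S p r ∧ chain (r ∷ K) (S ++ map (r ⊞_) S) ps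

points : List ℕ → Word 24 2
points ts = tabulate λ j → if any (toℕ j ℕ.≡ᵇ_) ts then l else o

-- Each row is listed with five of its points; order and points were found by computer so that every step is forced.
steps : List (Word 24 2 × Word 24 2)
steps = map (λ (ts , i) → points ts , lookup golayRows i)
  ( (11 ∷ 13 ∷ 15 ∷ 16 ∷ 17 ∷ [] , # 11)
  ∷ (10 ∷ 12 ∷ 15 ∷ 16 ∷ 21 ∷ [] , # 10)
  ∷ (11 ∷ 13 ∷ 14 ∷ 15 ∷ 20 ∷ [] , # 9)
  ∷ ( 9 ∷ 11 ∷ 12 ∷ 13 ∷ 17 ∷ [] , # 7)
  ∷ ( 7 ∷  9 ∷ 10 ∷ 15 ∷ 23 ∷ [] , # 5)
  ∷ (10 ∷ 12 ∷ 13 ∷ 18 ∷ 19 ∷ [] , # 8)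
  ∷ ( 8 ∷ 10 ∷ 11 ∷ 12 ∷ 16 ∷ [] , # 6)
  ∷ ( 5 ∷  7 ∷  8 ∷  9 ∷ 13 ∷ [] , # 3)
  ∷ ( 5 ∷  6 ∷ 10 ∷ 11 ∷ 23 ∷ [] , # 0)
  ∷ ( 1 ∷  3 ∷  5 ∷  6 ∷  7 ∷ [] , # 1)
  ∷ ( 6 ∷  8 ∷  9 ∷ 10 ∷ 14 ∷ [] , # 4)
  ∷ ( 4 ∷  6 ∷  7 ∷  8 ∷ 12 ∷ [] , # 2) ∷ [])

-- Twelve steps, each over the 969 words of weight 8 through the listed points, against spans
-- growing from 1 to 2048 words.
chain-check : chain [] (𝟎 ∷ []) steps ≡ true
chain-check = refl

-- Addition of binary words and permutation of coordinates.

⊕-assoc : ∀ a b c → (a ⊕ b) ⊕ c ≡ a ⊕ (b ⊕ c)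
⊕-assoc zero       b          c          = refl
⊕-assoc (suc zero) zero       c          = refl
⊕-assoc (suc zero) (suc zero) zero       = refl
⊕-assoc (suc zero) (suc zero) (suc zero) = refl

⊕-identityʳ : ∀ a → a ⊕ o ≡ a
⊕-identityʳ zero       = refl
⊕-identityʳ (suc zero) = refl

⊕-self : ∀ a → a ⊕ a ≡ o
⊕-self zero       = refl
⊕-self (suc zero) = refl

⊞-assoc : ∀ {n} (x y z : Word n 2) → (x ⊞ y) ⊞ z ≡ x ⊞ (y ⊞ z)
⊞-assoc = zipWith-assoc ⊕-assoc

⊞-identityʳ : ∀ {n} (x : Word n 2) → x ⊞ 𝟎 ≡ x
⊞-identityʳ = zipWith-identityʳ ⊕-identityʳ

⊞-identityˡ : ∀ {n} (x : Word n 2) → 𝟎 ⊞ x ≡ x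
⊞-identityˡ = zipWith-identityˡ (λ _ → refl)

⊞-self : ∀ {n} (x : Word n 2) → x ⊞ x ≡ 𝟎
⊞-self []      = refl
⊞-self (a ∷ x) = cong₂ _∷_ (⊕-self a) (⊞-self x)

⊞-cancelʳ : ∀ {n} (x y : Word n 2) → (x ⊞ y) ⊞ y ≡ x
⊞-cancelʳ x y = trans (⊞-assoc x y y) (trans (cong (x ⊞_) (⊞-self y)) (⊞-identityʳ x))

rearrange : ∀ {A : Set} {m n} → (Fin m → Fin n) → Vec A n → Vec A m
rearrange τ x = tabulate (lookup x ∘ τ)

rearrange-inverse : ∀ {A : Set} {m n} (τ : Fin m → Fin n) (τ' : Fin n → Fin m) →
  (∀ i → τ (τ' i) ≡ i) → (x : Vec A n) → rearrange τ' (rearrange τ x) ≡ x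
rearrange-inverse τ τ' inv x = trans
  (tabulate-cong λ i → trans (lookup∘tabulate (lookup x ∘ τ) (τ' i)) (cong (lookup x) (inv i)))
  (tabulate∘lookup x)

rearrange-∘ : ∀ {A : Set} {k m n} (τ : Fin k → Fin m) (τ' : Fin m → Fin n) (x : Vec A n) →
  rearrange τ (rearrange τ' x) ≡ rearrange (τ' ∘ τ) x
rearrange-∘ τ τ' x = tabulate-cong λ j → lookup∘tabulate (lookup x ∘ τ') (τ j)

rearrange-⊞ : ∀ {m n} (τ : Fin m → Fin n) (x y : Word n 2) →
  rearrange τ (x ⊞ y) ≡ rearrange τ x ⊞ rearrange τ y
rearrange-⊞ {zero}  τ x y = refl
rearrange-⊞ {suc m} τ x y = cong₂ _∷_ (lookup-zipWith _⊕_ (τ zero) x y) (rearrange-⊞ (τ ∘ suc) x y)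

wt-sum : ∀ {n} (x : Word n 2) → wt x ≡ sum (toℕ ∘ lookup x)
wt-sum []      = refl
wt-sum (b ∷ x) = cong (toℕ b ℕ.+_) (wt-sum x)

wt-rearrange : ∀ {m n} (τ : Fin m ↔ Fin n) (x : Word n 2) → wt (rearrange (to τ) x) ≡ wt x
wt-rearrange τ x = begin
  wt (rearrange (to τ) x)                   ≡⟨ wt-sum (rearrange (to τ) x) ⟩
  sum (toℕ ∘ lookup (rearrange (to τ) x))   ≡⟨ sum-cong-≗ (λ i → cong toℕ (lookup∘tabulate (lookup x ∘ to τ) i)) ⟩
  sum (toℕ ∘ lookup x ∘ to τ)               ≡⟨ sum-permute (toℕ ∘ lookup x) τ ⟨
  sum (toℕ ∘ lookup x)                      ≡⟨ wt-sum x ⟨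
  wt x                                      ∎
  where open ≡-Reasoning

infix 4 _⊑_
_⊑_ : ∀ {n} → Word n 2 → Word n 2 → Set
p ⊑ w = ∀ j → lookup p j ≡ l → lookup w j ≡ l

-- A predicate instead of a list of words makes a change of coordinates a mere composition with
-- `rearrange`. Only the existence of an octad is asked: two octads sharing five points are at
-- distance at most 6, so `weights` and `closed` make them equal.
record GolayLike {n} (P : Word n 2 → Set) : Set where
  field
    zero∈   : P 𝟎
    closed  : ∀ {x y} → P x → P y → P (x ⊞ y)
    weights : ∀ {x} → P x → okWeight (wt x) ≡ true
    octad   : ∀ p → wt p ≡ 5 → ∃[ w ] (P w × wt w ≡ 8 × p ⊑ w)
open GolayLike using (zero∈; closed; weights; octad)

rearrange-zero : ∀ {m n} (τ : Fin m → Fin n) → rearrange τ 𝟎 ≡ 𝟎 {m}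
rearrange-zero {zero}  τ = refl
rearrange-zero {suc m} τ = cong₂ _∷_ (lookup-replicate (τ zero) o) (rearrange-zero (τ ∘ suc))

-- Allows the coordinates to change after each row. For the octads, the five points are moved, an
-- octad is taken there and moved back.
GolayLike-rearrange : ∀ {n} {P : Word n 2 → Set} → GolayLike P → (τ : Fin n ↔ Fin n) → GolayLike (P ∘ rearrange (to τ))
GolayLike-rearrange {P = P} G τ = record
  { zero∈   = subst P (sym (rearrange-zero (to τ))) (zero∈ G)
  ; closed  = λ {x} {y} px py → subst P (sym (rearrange-⊞ (to τ) x y)) (closed G px py)
  ; weights = λ {x} px → subst (λ k → okWeight k ≡ true) (wt-rearrange τ x) (weights G px)
  ; octad   = oct
  }
  where
  oct : ∀ p → wt p ≡ 5 → ∃[ w ] (P (rearrange (to τ) w) × wt w ≡ 8 × p ⊑ w)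
  oct p wp with octad G (rearrange (to τ) p) (trans (wt-rearrange τ p) wp)
  ... | w , pw , ww , sub = rearrange (from τ) w , subst P (sym back) pw
      , trans (sym (wt-rearrange τ (rearrange (from τ) w))) (trans (cong wt back) ww)
      , λ j pj → trans (lookup∘tabulate (lookup w ∘ from τ) j)
          (sub (from τ j) (trans (lookup∘tabulate (lookup p ∘ to τ) (from τ j))
                                 (trans (cong (lookup p) (strictlyInverseˡ τ j)) pj)))
    where
    back : rearrange (to τ) (rearrange (from τ) w) ≡ w
    back = rearrange-inverse (from τ) (to τ) (strictlyInverseʳ τ) w

-- Soundness of the row by row construction.

forallAbove-sound : ∀ {n} (p : Word n 2) k (t : Word n 2 → Bool) → forallAbove p k t ≡ true →
  ∀ w → wt w ≡ k → p ⊑ w → t w ≡ true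
forallAbove-sound []               zero    t e []               _  _ = e
forallAbove-sound (zero ∷ p)       zero    t e (zero ∷ w)       ww s = forallAbove-sound p 0 _ e w ww (s ∘ suc)
forallAbove-sound (zero ∷ p)       (suc k) t e (zero ∷ w)       ww s = forallAbove-sound p (suc k) _ (∧-conicalʳ _ _ e) w ww (s ∘ suc)
forallAbove-sound (zero ∷ p)       (suc k) t e (suc zero ∷ w)   ww s = forallAbove-sound p k _ (∧-conicalˡ _ _ e) w (ℕ.suc-injective ww) (s ∘ suc)
forallAbove-sound (suc zero ∷ p)   k       t e (zero ∷ w)       ww s with () ← s zero refl
forallAbove-sound (suc zero ∷ p)   (suc k) t e (suc zero ∷ w)   ww s = forallAbove-sound p k _ e w (ℕ.suc-injective ww) (s ∘ suc)

does-sound : ∀ {A : Set} (d : Dec A) → does d ≡ true → A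
does-sound (yes a) _ = a

all-sound : ∀ {A : Set} (t : A → Bool) xs → all t xs ≡ true → All (λ x → t x ≡ true) xs
all-sound t []       _ = []
all-sound t (x ∷ xs) e = ∧-conicalˡ _ _ e ∷ all-sound t xs (∧-conicalʳ _ _ e)

any-none : ∀ {A : Set} (t : A → Bool) {xs} → All (λ x → t x ≡ false) xs → any t xs ≡ false
any-none t []       = refl
any-none t (e ∷ es) rewrite e = any-none t es

rearrange-map : ∀ {A : Set} {m n} (ρ : Vec (Fin n) m) (x : Vec A n) → rearrange (lookup ρ) x ≡ Vec.map (lookup x) ρ
rearrange-map []      x = refl
rearrange-map (i ∷ ρ) x = cong (lookup x i ∷_) (rearrange-map ρ x)

permutation : ∀ {n} (ρ π : Vec (Fin n) n) → Vec.map (lookup ρ) π ≡ Vec.allFin n → Vec.map (lookup π) ρ ≡ Vec.allFin n → Fin n ↔ Fin n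
permutation {n} ρ π ρπ πρ = mk↔ₛ′ (lookup ρ) (lookup π) (inverse ρ π ρπ) (inverse π ρ πρ)
  where
  inverse : ∀ (ρ π : Vec (Fin n) n) → Vec.map (lookup ρ) π ≡ Vec.allFin n → ∀ i → lookup ρ (lookup π i) ≡ i
  inverse ρ π e i = trans (sym (lookup-map i (lookup ρ) π)) (trans (cong (λ v → lookup v i) e) (lookup-allFin i))

isPermTaking-sound : ∀ {n} (ρ π : Vec (Fin n) n) K r w → isPermTaking ρ π K r w ≡ true →
  Σ (Fin n ↔ Fin n) λ τ → rearrange (to τ) r ≡ w × All (λ k → rearrange (to τ) k ≡ k) K
isPermTaking-sound {n} ρ π K r w e =
    permutation ρ π (does-sound d₁ (∧-conicalˡ (does d₁) b₁ e)) (does-sound d₂ (∧-conicalˡ (does d₂) b₂ e₁))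
  , trans (rearrange-map ρ r) (does-sound d₃ (∧-conicalˡ (does d₃) b₃ e₂))
  , All.map (λ {k} ek → trans (rearrange-map ρ k) (does-sound (fixed k) ek))
      (all-sound (does ∘ fixed) K (∧-conicalʳ (does d₃) b₃ e₂))
  where
  d₁ = ≡-dec _≟_ (Vec.map (lookup ρ) π) (Vec.allFin n)
  d₂ = ≡-dec _≟_ (Vec.map (lookup π) ρ) (Vec.allFin n)
  d₃ = ≡-dec _≟_ (Vec.map (lookup r) ρ) w
  fixed : (k : Word n 2) → Dec (Vec.map (lookup k) ρ ≡ k)
  fixed k = ≡-dec _≟_ (Vec.map (lookup k) ρ) k
  b₃ = all (does ∘ fixed) K
  b₂ = does d₃ ∧ b₃
  b₁ = does d₂ ∧ b₂
  e₁ = ∧-conicalʳ (does d₁) b₁ e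
  e₂ = ∧-conicalʳ (does d₂) b₂ e₁

incompatible-sound : ∀ {n} {P : Word n 2 → Set} → GolayLike P → ∀ {S w} → All P S → P w → incompatible S w ≡ false
incompatible-sound G pS pw = any-none _ (All.map (λ ps → cong not (weights G (closed G pw ps))) pS)

∨-resolve : ∀ {a b} → a ≡ false → a ∨ b ≡ true → b ≡ true
∨-resolve refl e = e

-- An octad `w` through `p` exists and is compatible with `S` because its sums with words of the
-- code have admissible weight. The check then supplies `τ` taking `r` to `w`, so that `r` lies in
-- the code pulled back along `τ`.
forced-sound : ∀ {m} {P : Word (suc m) 2 → Set} → GolayLike P → ∀ K S p r → wt p ≡ 5 → forced K S p r ≡ true → All P K → All P S →
  Σ (Fin (suc _) ↔ Fin (suc _)) λ τ → P (rearrange (to τ) r) × All (λ k → rearrange (to τ) k ≡ k) K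
forced-sound {P = P} G K S p r wp e pK pS with octad G p wp
... | w , pw , ww , s = let τ , τr , τK = isPermTaking-sound (matching cw cr) (matching cr cw) K r w mov in τ , subst P (sym τr) pw , τK
  where
  cw = columns (w ∷ K)
  cr = columns (r ∷ K)
  mov : movable cw cr K r w ≡ true
  mov = ∨-resolve (incompatible-sound G pS pw) (forallAbove-sound p 8 _ e w ww s)

-- S lies in the span of K; quantifying over Q makes this survive a change of coordinates.
chain-sound : ∀ {m} {P : Word (suc m) 2 → Set} → GolayLike P → ∀ K S ps → All (λ pr → wt (proj₁ pr) ≡ 5) ps → chain K S ps ≡ true →
  All P K → (∀ {Q : Word (suc m) 2 → Set} → GolayLike Q → All Q K → All Q S) →
  Σ (Fin (suc _) ↔ Fin (suc _)) λ τ → All (P ∘ rearrange (to τ)) K × All (P ∘ rearrange (to τ) ∘ proj₂) ps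
chain-sound {P = P} G K S [] _ _ pK _ =
  ↔-id _ , All.map (λ {k} → subst P (sym (tabulate∘lookup k))) pK , []
chain-sound {m} {P} G K S ((p , r) ∷ ps) (wp ∷ wps) e pK spanned
  with τ , pr , τK ← forced-sound G K S p r wp (∧-conicalˡ _ _ e) pK (spanned G pK)
  -- The recursion takes place in the code pulled back along `τ`. The rows placed earlier still lie
  -- in it because `τ` fixes them.
  with τ' , pr' ∷ pK' , pps ← chain-sound (GolayLike-rearrange G τ) (r ∷ K) (S ++ map (r ⊞_) S) ps wps
         (∧-conicalʳ (forced K S p r) _ e)
         (pr ∷ All.zipWith (λ { {k} (pk , τk) → subst P (sym τk) pk }) (pK , τK))
         (λ { H (qr ∷ qK) → All.++⁺ (spanned H qK) (All.map⁺ (All.map (closed H qr) (spanned H qK))) })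
  = τ' ↔-∘ τ , All.map (λ {k} → compose k) pK' , compose r pr' ∷ All.map (λ {pr} → compose (proj₂ pr)) pps
  where
  compose : ∀ x → P (rearrange (to τ) (rearrange (to τ') x)) → P (rearrange (to τ' ∘ to τ) x)
  compose x = subst P (rearrange-∘ (to τ) (to τ') x)

-- From the generator rows to the whole Golay code.

forallWords : ∀ n → (Word n 2 → Bool) → Bool
forallWords zero    t = t []
forallWords (suc n) t = forallWords n (t ∘ (o ∷_)) ∧ forallWords n (t ∘ (l ∷_))

forallWords-sound : ∀ n t → forallWords n t ≡ true → ∀ x → t x ≡ true
forallWords-sound zero    t e []             = e
forallWords-sound (suc n) t e (zero ∷ x)     = forallWords-sound n _ (∧-conicalˡ _ _ e) x
forallWords-sound (suc n) t e (suc zero ∷ x) = forallWords-sound n _ (∧-conicalʳ (forallWords n (t ∘ (o ∷_))) _ e) x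

-- Forward substitution; correct when the first k columns of the rows form a unitriangular matrix.
solve : ∀ {k n} → Vec (Word (k ℕ.+ n) 2) k → Word (k ℕ.+ n) 2 → Word k 2
solve []       _       = []
solve (r ∷ rs) (b ∷ y) = b ∷ solve (Vec.map Vec.tail rs) (if does (b ≟ l) then y ⊞ Vec.tail r else y)

-- `solve` reads only the first twelve entries of the target, so the other twelve may be filled with
-- zeros.
message : Word 12 2 → Word 12 2
message v = solve golayRows (v Vec.++ 𝟎)

systematic? : ∀ v → Dec (Vec.take 12 (encode (message v) golayRows) ≡ v)
systematic? v = ≡-dec _≟_ (Vec.take 12 (encode (message v) golayRows)) v

systematic-check : forallWords 12 (λ v → does (systematic? v)) ≡ true
systematic-check = refl

-- Admissible weights are divisible by 4. If a word and its sums with the rows, which have weight 8,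
-- are admissible, then the word meets every row evenly. It therefore lies in the dual, which is the
-- Golay code itself, where only zero vanishes on the first twelve coordinates.
selfDual-check : forallWords 12 (λ v →
  incompatible (𝟎 ∷ Vec.toList golayRows) (𝟎 {12} Vec.++ v) ∨ does (≡-dec _≟_ v 𝟎)) ≡ true
selfDual-check = refl

encode∈ : ∀ {n} {P : Word n 2 → Set} → GolayLike P → ∀ {k} {rs : Vec (Word n 2) k} → VAll.All P rs → ∀ m → P (encode m rs)
encode∈ G VAll.[]         []             = zero∈ G
encode∈ G (pr VAll.∷ prs) (zero ∷ m)     = encode∈ G prs m
encode∈ G (pr VAll.∷ prs) (suc zero ∷ m) = closed G pr (encode∈ G prs m)

fromVec : ∀ {A : Set} {P : A → Set} {k} {rs : Vec A k} → VAll.All P rs → All P (Vec.toList rs)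
fromVec VAll.[]         = []
fromVec (pr VAll.∷ prs) = pr ∷ fromVec prs

-- The combination `e` of the rows that agrees with `y` on the first `k` coordinates is subtracted.
-- The difference is in the code and vanishes there, so `kernel` makes it zero.
selfDual⇒encode : ∀ {k k'} {P : Word (k ℕ.+ k') 2 → Set} → GolayLike P →
  (rs : Vec (Word (k ℕ.+ k') 2) k) → VAll.All P rs →
  (msg : Word k 2 → Word k 2) → (∀ v → Vec.take k (encode (msg v) rs) ≡ v) →
  (∀ v → P (𝟎 {k} Vec.++ v) → v ≡ 𝟎) →
  ∀ y → P y → ∃[ m ] y ≡ encode m rs
selfDual⇒encode {k} {k'} {P} G rs prs msg systematic kernel y py = m , (begin
  y                     ≡⟨ ⊞-cancelʳ y e ⟨
  (y ⊞ e) ⊞ e           ≡⟨ cong (_⊞ e) split ⟩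
  (𝟎 {k} Vec.++ v) ⊞ e  ≡⟨ cong (λ v → (𝟎 {k} Vec.++ v) ⊞ e) (kernel v (subst P split (closed G py (encode∈ G prs m)))) ⟩
  (𝟎 {k} Vec.++ 𝟎) ⊞ e  ≡⟨ cong (_⊞ e) (replicate-++ k) ⟩
  𝟎 ⊞ e                 ≡⟨ ⊞-identityˡ e ⟩
  e                     ∎)
  where
  open ≡-Reasoning
  m = msg (Vec.take k y)
  e = encode m rs
  v = Vec.drop k (y ⊞ e)
  replicate-++ : ∀ k → 𝟎 {k} Vec.++ 𝟎 {k'} ≡ 𝟎
  replicate-++ zero    = refl
  replicate-++ (suc k) = cong (o ∷_) (replicate-++ k)
  split : y ⊞ e ≡ 𝟎 Vec.++ v
  split = trans (sym (take++drop≡id k (y ⊞ e))) (cong (Vec._++ v)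
    (trans (take-zipWith {m = k} _⊕_ y e) (trans (cong (Vec.take k y ⊞_) (systematic (Vec.take k y))) (⊞-self (Vec.take k y)))))

golay-kernel : ∀ {P : Word 24 2 → Set} → GolayLike P → VAll.All P golayRows → ∀ v → P (𝟎 {12} Vec.++ v) → v ≡ 𝟎
golay-kernel G prs v pv = does-sound (≡-dec _≟_ v 𝟎)
  (∨-resolve (incompatible-sound G {𝟎 ∷ Vec.toList golayRows} {𝟎 {12} Vec.++ v} (zero∈ G ∷ fromVec prs) pv)
    (forallWords-sound 12 (λ v → incompatible (𝟎 ∷ Vec.toList golayRows) (𝟎 {12} Vec.++ v) ∨ does (≡-dec _≟_ v 𝟎)) selfDual-check v))

GolayLike⇒Golay24 : ∀ {P : Word 24 2 → Set} → GolayLike P → VAll.All P golayRows → ∀ y → P y ⇔ Golay24 y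
GolayLike⇒Golay24 G prs y = mk⇔
  (selfDual⇒encode {12} {12} G golayRows prs message
    (λ v → does-sound (systematic? v) (forallWords-sound 12 (does ∘ systematic?) systematic-check v))
    (golay-kernel G prs) y)
  λ { (m , refl) → encode∈ G prs m }

reorder : ∀ {P : Word 24 2 → Set} → All (P ∘ proj₂) steps → VAll.All P golayRows
reorder (p₁₁ ∷ p₁₀ ∷ p₉ ∷ p₇ ∷ p₅ ∷ p₈ ∷ p₆ ∷ p₃ ∷ p₀ ∷ p₁ ∷ p₄ ∷ p₂ ∷ []) =
  p₀ VAll.∷ p₁ VAll.∷ p₂ VAll.∷ p₃ VAll.∷ p₄ VAll.∷ p₅ VAll.∷ p₆ VAll.∷ p₇ VAll.∷ p₈ VAll.∷ p₉ VAll.∷ p₁₀ VAll.∷ p₁₁ VAll.∷ VAll.[]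

steps-weights : All (λ pr → wt (proj₁ pr) ≡ 5) steps
steps-weights = refl ∷ refl ∷ refl ∷ refl ∷ refl ∷ refl ∷ refl ∷ refl ∷ refl ∷ refl ∷ refl ∷ refl ∷ []

steps-rearranged : ∀ {P : Word 24 2 → Set} → GolayLike P →
  Σ (Fin 24 ↔ Fin 24) λ τ → All (λ pr → P (rearrange (to τ) (proj₂ pr))) steps
steps-rearranged {P} G =
  let τ , _ , prs = chain-sound {P = P} G [] (𝟎 ∷ []) steps steps-weights chain-check [] (λ H _ → zero∈ H ∷ [])
  in τ , prs

rearranged⇒Golay24 : ∀ {P : Word 24 2 → Set} → GolayLike P → (τ : Fin 24 ↔ Fin 24) →
  VAll.All (P ∘ rearrange (to τ)) golayRows → ∀ y → P (rearrange (to τ) y) ⇔ Golay24 y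
rearranged⇒Golay24 {P} G τ = GolayLike⇒Golay24 {P ∘ rearrange (to τ)} (GolayLike-rearrange G τ)

GolayLike-unique : ∀ {P : Word 24 2 → Set} → GolayLike P →
  Σ (Fin 24 ↔ Fin 24) λ τ → ∀ y → P (rearrange (to τ) y) ⇔ Golay24 y
GolayLike-unique {P} G = proj₁ (steps-rearranged G) ,
  rearranged⇒Golay24 G (proj₁ (steps-rearranged G))
    (reorder {λ y → P (rearrange (to (proj₁ (steps-rearranged G))) y)} (proj₂ (steps-rearranged G)))

-- Factorial moments of a design

module _ {A : Set} where

  ∑ : List A → (A → ℤ) → ℤ
  ∑ []       f = 0ℤ
  ∑ (x ∷ xs) f = f x + ∑ xs f

  ∑-cong-∈ : ∀ xs {f g : A → ℤ} → (∀ {x} → x ∈ xs → f x ≡ g x) → ∑ xs f ≡ ∑ xs g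
  ∑-cong-∈ []       e = refl
  ∑-cong-∈ (x ∷ xs) e = cong₂ _+_ (e (here refl)) (∑-cong-∈ xs (e ∘ there))

  ∑-cong : ∀ xs {f g : A → ℤ} → (∀ x → f x ≡ g x) → ∑ xs f ≡ ∑ xs g
  ∑-cong xs e = ∑-cong-∈ xs (λ {x} _ → e x)

  ∑-+ : ∀ xs (f g : A → ℤ) → ∑ xs (λ x → f x + g x) ≡ ∑ xs f + ∑ xs g
  ∑-+ []       f g = refl
  ∑-+ (x ∷ xs) f g = trans (cong (λ r → f x + g x + r) (∑-+ xs f g)) (interchange (f x) (g x) (∑ xs f) (∑ xs g))
    where
    interchange : ∀ a b c d → (a + b) + (c + d) ≡ (a + c) + (b + d)
    interchange = solve-∀

  ∑-*ˡ : ∀ c xs (f : A → ℤ) → ∑ xs (λ x → c * f x) ≡ c * ∑ xs f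
  ∑-*ˡ c []       f = sym (*-zeroʳ c)
  ∑-*ˡ c (x ∷ xs) f = trans (cong (λ r → c * f x + r) (∑-*ˡ c xs f)) (sym (*-distribˡ-+ c (f x) (∑ xs f)))

  ∑-const : ∀ c xs → ∑ xs (λ (_ : A) → c) ≡ + length xs * c
  ∑-const c []       = refl
  ∑-const c (x ∷ xs) = trans (cong (_+_ c) (∑-const c xs)) (suc-* c (+ length xs))
    where
    suc-* : ∀ c k → c + k * c ≡ (1ℤ + k) * c
    suc-* = solve-∀

  ∑-zero : ∀ xs {f : A → ℤ} → (∀ {x} → x ∈ xs → f x ≡ 0ℤ) → ∑ xs f ≡ 0ℤ
  ∑-zero xs e = trans (∑-cong-∈ xs e) (trans (∑-const 0ℤ xs) (*-zeroʳ (+ length xs)))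

  ∑-++ : ∀ xs ys (f : A → ℤ) → ∑ (xs ++ ys) f ≡ ∑ xs f + ∑ ys f
  ∑-++ []       ys f = sym (+-identityˡ _)
  ∑-++ (x ∷ xs) ys f = trans (cong (λ r → f x + r) (∑-++ xs ys f)) (+-assoc′ (f x) (∑ xs f) (∑ ys f))
    where
    +-assoc′ : ∀ a b c → a + (b + c) ≡ (a + b) + c
    +-assoc′ = solve-∀

  ∑-↭ : ∀ {xs ys} (f : A → ℤ) → xs ↭ ys → ∑ xs f ≡ ∑ ys f
  ∑-↭ f ↭.refl          = refl
  ∑-↭ f (↭.prep x p)    = cong (λ r → f x + r) (∑-↭ f p)
  ∑-↭ f (↭.swap {xs} {ys} x y p) = trans (cong (λ s → f x + (f y + s)) (∑-↭ f p)) (exchange (f x) (f y) (∑ ys f))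
    where
    exchange : ∀ a b c → a + (b + c) ≡ b + (a + c)
    exchange = solve-∀
  ∑-↭ f (↭.trans p p')  = trans (∑-↭ f p) (∑-↭ f p')

  ∑-multiple : ∀ t xs (f : A → ℤ) → (∀ {x} → x ∈ xs → ∃[ k ] f x ≡ t * k) → ∃[ k ] ∑ xs f ≡ t * k
  ∑-multiple t []       f m = 0ℤ , sym (*-zeroʳ t)
  ∑-multiple t (x ∷ xs) f m with m (here refl) | ∑-multiple t xs f (m ∘ there)
  ... | k , e | k' , e' = k + k' , trans (cong₂ _+_ e e') (sym (*-distribˡ-+ t k k'))

  Unique-resp-↭ : ∀ {xs ys : List A} → xs ↭ ys → Unique xs → Unique ys
  Unique-resp-↭ p = Setoid↭.Unique-resp-↭ (≡.setoid A) (↭⇒↭ₛ p)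

  Unique-++⁻ˡ : ∀ xs {ys : List A} → Unique (xs ++ ys) → Unique xs
  Unique-++⁻ˡ []       _        = []
  Unique-++⁻ˡ (x ∷ xs) (p ∷ ps) = All.++⁻ˡ xs p ∷ Unique-++⁻ˡ xs ps

  ∈⇒↭ : ∀ {x : A} {xs} → x ∈ xs → ∃[ ys ] xs ↭ x ∷ ys
  ∈⇒↭ x∈xs with as , bs , refl ← ∈-∃++ x∈xs = as ++ bs , shift _ as bs

  complement : ∀ (xs : List A) {ys} → Unique xs → (∀ {x} → x ∈ xs → x ∈ ys) → ∃[ zs ] ys ↭ xs ++ zs
  complement []       {ys} _        _   = ys , ↭.refl
  complement (x ∷ xs) {ys} (p ∷ ps) sub =
    let ys' , r = ∈⇒↭ (sub (here refl))
        sub' : ∀ {z} → z ∈ xs → z ∈ ys'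
        sub' = λ z∈ → case z∈ (∈-resp-↭ r (sub (there z∈)))
        zs , s = complement xs ps sub'
    in zs , ↭.trans r (↭.prep x s)
    where
    case : ∀ {z ys'} → z ∈ xs → z ∈ x ∷ ys' → z ∈ ys'
    case z∈ (here refl) = ⊥-elim (All.lookup p z∈ refl)
    case z∈ (there q)   = q

  -- Isolates the term of a central codeword, which occurs once by uniqueness. With `t` zero all
  -- other terms vanish; with `t` nonzero, `k` counts them with multiplicity.
  ∑-except : ∀ t xs (f : A → ℤ) {x} → Unique xs → x ∈ xs → (∀ {y} → y ∈ xs → y ≢ x → ∃[ k ] f y ≡ t * k) →
    ∃[ k ] ∑ xs f ≡ f x + t * k
  ∑-except t xs f {x} u x∈ m with ys , r ← ∈⇒↭ x∈ with x∉ ∷ _ ← Unique-resp-↭ r u =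
    let k , e = ∑-multiple t ys f (λ y∈ → m (∈-resp-↭ (↭-sym r) (there y∈)) (λ y≡x → All.lookup x∉ y∈ (sym y≡x)))
    in k , trans (∑-↭ f r) (cong (λ r → f x + r) e)

∑-comm : ∀ {A B : Set} (xs : List A) (ys : List B) (f : A → B → ℤ) →
  ∑ xs (λ x → ∑ ys (f x)) ≡ ∑ ys (λ y → ∑ xs (λ x → f x y))
∑-comm []       ys f = sym (∑-zero ys (λ _ → refl))
∑-comm (x ∷ xs) ys f = trans (cong (λ r → ∑ ys (f x) + r) (∑-comm xs ys f)) (sym (∑-+ ys (f x) _))

δ : ∀ {q} → Fin q → Fin q → ℤ
δ a b = if does (a ≟ b) then 1ℤ else 0ℤ

δ-eq : ∀ {q} {a b : Fin q} → a ≡ b → δ a b ≡ 1ℤ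
δ-eq {a = a} {b} e with a ≟ b
... | yes _ = refl
... | no ne = ⊥-elim (ne e)

δ-neq : ∀ {q} {a b : Fin q} → a ≢ b → δ a b ≡ 0ℤ
δ-neq {a = a} {b} ne with a ≟ b
... | yes e = ⊥-elim (ne e)
... | no _  = refl

∑-tabulate : ∀ {A : Set} {m} (g : Fin m → A) (f : A → ℤ) → ∑ (List.tabulate g) f ≡ ∑ (allFin m) (f ∘ g)
∑-tabulate {m = zero}  g f = refl
∑-tabulate {m = suc m} g f = cong (λ r → f (g zero) + r) (trans (∑-tabulate (g ∘ suc) f) (sym (∑-tabulate suc (f ∘ g))))

∑-δ : ∀ {q} (a : Fin q) → ∑ (allFin q) (δ a) ≡ 1ℤ
∑-δ {suc q} zero    = cong (λ r → 1ℤ + r) (trans (∑-tabulate {m = q} suc (δ zero)) (∑-zero (allFin q) {δ zero ∘ suc} (λ _ → refl)))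
∑-δ {suc q} (suc a) = trans (+-identityˡ _) (trans (∑-tabulate {m = q} suc (δ (suc a))) (∑-δ a))

fall : ℕ → ℤ → ℤ
fall zero    z = 1ℤ
fall (suc k) z = z * fall k (z - 1ℤ)

fall-last : ∀ k z → fall (suc k) z ≡ fall k z * (z - + k)
fall-last zero    z = lemma z
  where
  lemma : ∀ z → z * 1ℤ ≡ 1ℤ * (z - 0ℤ)
  lemma = solve-∀
fall-last (suc k) z = trans (cong (z *_) (fall-last k (z - 1ℤ))) (lemma z (fall k (z - 1ℤ)) (+ k))
  where
  lemma : ∀ z f k → z * (f * (z - 1ℤ - k)) ≡ z * f * (z - (1ℤ + k))
  lemma = solve-∀

fall-suc : ∀ k z → fall (suc k) (1ℤ + z) ≡ fall (suc k) z + (+ suc k) * fall k z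
fall-suc k z = begin
  (1ℤ + z) * fall k (1ℤ + z - 1ℤ)             ≡⟨ cong (λ w → (1ℤ + z) * fall k w) (back z) ⟩
  (1ℤ + z) * fall k z                         ≡⟨ lemma z (fall k z) (+ k) ⟩
  fall k z * (z - + k) + (+ suc k) * fall k z ≡⟨ cong (_+ (+ suc k) * fall k z) (fall-last k z) ⟨
  fall (suc k) z + (+ suc k) * fall k z       ∎
  where
  open ≡-Reasoning
  back : ∀ z → 1ℤ + z - 1ℤ ≡ z
  back = solve-∀
  lemma : ∀ z f k → (1ℤ + z) * f ≡ f * (z - k) + (1ℤ + k) * f
  lemma = solve-∀

-- The Pascal rule for falling factorials, for an increment that is 0 or 1. It removes one
-- coordinate from an agreement count and drives the induction in `moment-on`.
fall-δ : ∀ {q} k (a b : Fin q) z → fall (suc k) (δ a b + z) ≡ fall (suc k) z + (+ suc k) * (δ a b * fall k z)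
fall-δ k a b z with does (a ≟ b)
... | true  = trans (fall-suc k z) (cong (λ w → fall (suc k) z + + suc k * w) (sym (*-identityˡ (fall k z))))
... | false = trans (cong (fall (suc k)) (+-identityˡ z)) (sym (trans (cong (λ r → fall (suc k) z + r) (trans (cong (+ suc k *_) (*-zeroˡ (fall k z))) (*-zeroʳ (+ suc k)))) (+-identityʳ _)))

-- Indicators of prescribed entries and counts of agreements.

module _ {n q : ℕ} where

  ind : ∀ {j} → Vec (Fin n) j → Vec (Fin q) j → Word n q → ℤ
  ind []       []      y = 1ℤ
  ind (i ∷ is) (s ∷ u) y = δ (lookup y i) s * ind is u y

  ind≡0⊎match : ∀ {j} (is : Vec (Fin n) j) u y → ind is u y ≡ 0ℤ ⊎ ∀ t → lookup y (lookup is t) ≡ lookup u t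
  ind≡0⊎match []       []      y = inj₂ λ ()
  ind≡0⊎match (i ∷ is) (s ∷ u) y with lookup y i ≟ s
  ... | no _  = inj₁ refl
  ... | yes e with ind≡0⊎match is u y
  ...   | inj₁ z = inj₁ (trans (*-identityˡ _) z)
  ...   | inj₂ m = inj₂ λ { zero → e ; (suc t) → m t }

  agree : List (Fin n) → Word n q → Word n q → ℤ
  agree L x y = ∑ L (λ i → δ (lookup y i) (lookup x i))

  ind-does : ∀ {j} (is : Vec (Fin n) j) u y →
    ind is u y ≡ (if does (≡-dec _≟_ (restrict (lookup is) y) u) then 1ℤ else 0ℤ)
  ind-does []       []      y = refl
  ind-does (i ∷ is) (s ∷ u) y with does (lookup y i ≟ s)
  ... | true  = trans (*-identityˡ _) (ind-does is u y)
  ... | false = refl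

  length-filter : ∀ {j} (is : Vec (Fin n) j) u (ws : List (Word n q)) →
    + length (filter (λ c → ≡-dec _≟_ (restrict (lookup is) c) u) ws) ≡ ∑ ws (ind is u)
  length-filter is u []       = refl
  length-filter is u (y ∷ ws)
    rewrite ind-does is u y with does (≡-dec _≟_ (restrict (lookup is) y) u)
  ... | true  = cong (λ r → 1ℤ + r) (length-filter is u ws)
  ... | false = trans (length-filter is u ws) (sym (+-identityˡ _))

module _ {n : ℕ} where

  lookup-injective : ∀ {j} (is : Vec (Fin n) j) → Unique (toList is) → Injective _≡_ _≡_ (lookup is)
  lookup-injective (i ∷ is) (p ∷ ps) {zero}  {zero}  e = refl
  lookup-injective (i ∷ is) (p ∷ ps) {zero}  {suc t} e = ⊥-elim (distinct is p t e)
    where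
    distinct : ∀ {j} (is : Vec (Fin n) j) → All (i ≢_) (toList is) → ∀ t → i ≢ lookup is t
    distinct (_ ∷ _)  (p ∷ _)  zero    = p
    distinct (_ ∷ is) (_ ∷ ps) (suc t) = distinct is ps t
  lookup-injective (i ∷ is) (p ∷ ps) {suc s} {zero}  e = sym (lookup-injective (i ∷ is) (p ∷ ps) {zero} {suc s} (sym e))
  lookup-injective (i ∷ is) (p ∷ ps) {suc s} {suc t} e = cong suc (lookup-injective is ps e)

  complement-columns : ∀ {j} (is : Vec (Fin n) j) → Unique (toList is) →
    ∃[ L ] (allFin n ↭ toList is ++ L × n ≡ j ℕ.+ length L)
  complement-columns is u with L , r ← complement (toList is) u (λ {i} _ → ∈-allFin i) =
    L , r , (begin
      n                                ≡⟨ length-tabulate {n = n} (λ i → i) ⟨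
      length (allFin n)                ≡⟨ ↭-length r ⟩
      length (toList is ++ L)          ≡⟨ length-++ (toList is) ⟩
      length (toList is) ℕ.+ length L  ≡⟨ cong (ℕ._+ length L) (length-toList is) ⟩
      _ ℕ.+ length L                   ∎)
    where open ≡-Reasoning

  fresh : ∀ {j} (is : Vec (Fin n) j) → Unique (toList is) → j < n → ∃[ i ] Unique (i ∷ toList is)
  fresh {j} is u j<n with complement-columns is u
  ... | []    , _ , e = ⊥-elim (ℕ.<-irrefl (sym (trans e (ℕ.+-identityʳ j))) j<n)
  ... | i ∷ L , r , _ = i , Unique-++⁻ˡ (i ∷ toList is) (Unique-resp-↭ (↭.trans r (shift i (toList is) L)) (allFin⁺ n))

module Design {n q : ℕ} (C : Code n q) (t : ℕ) (t≤n : t ≤ n) (design : IsDesign t C) where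

  ws : List (Word n q)
  ws = words C

  count : ∀ {j} → Vec (Fin n) j → Vec (Fin q) j → ℤ
  count is u = ∑ ws (ind is u)

  count-extend : ∀ {j} (is : Vec (Fin n) j) u i → count is u ≡ ∑ (allFin q) (λ s → count (i ∷ is) (s ∷ u))
  count-extend is u i = begin
    ∑ ws (ind is u)
      ≡⟨ ∑-cong ws (λ y → begin
           ind is u y                                       ≡⟨ *-identityʳ _ ⟨
           ind is u y * 1ℤ                                  ≡⟨ cong (ind is u y *_) (∑-δ (lookup y i)) ⟨
           ind is u y * ∑ (allFin q) (δ (lookup y i))       ≡⟨ ∑-*ˡ (ind is u y) (allFin q) _ ⟨
           ∑ (allFin q) (λ s → ind is u y * δ (lookup y i) s) ≡⟨ ∑-cong (allFin q) (λ s → *-comm (ind is u y) _) ⟩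
           ∑ (allFin q) (λ s → ind (i ∷ is) (s ∷ u) y)      ∎) ⟩
    ∑ ws (λ y → ∑ (allFin q) (λ s → ind (i ∷ is) (s ∷ u) y))
      ≡⟨ ∑-comm ws (allFin q) _ ⟩
    ∑ (allFin q) (λ s → count (i ∷ is) (s ∷ u)) ∎
    where open ≡-Reasoning

  Uniform : ℕ → Set
  Uniform j = (is : Vec (Fin n) j) → Unique (toList is) → ∀ u v → count is u ≡ count is v

  uniform-top : Uniform t
  uniform-top is un u v = trans (sym (length-filter is u ws))
    (trans (cong +_ (proj₂ design (lookup is) (lookup-injective is un) u v)) (length-filter is v ws))

  -- Strength passes down: the count for `j` columns is the sum, over the symbols in one further
  -- column, of counts for `j + 1` columns. The bound `j < n` guarantees such a column.
  uniform-pred : ∀ {j} → j < n → Uniform (suc j) → Uniform j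
  uniform-pred j<n U is un u v with i , un' ← fresh is un j<n = trans (count-extend is u i)
    (trans (∑-cong (allFin q) (λ s → U (i ∷ is) un' (s ∷ u) (s ∷ v))) (sym (count-extend is v i)))

  uniform-below : ∀ d {j} → d ℕ.+ j ≡ t → Uniform j
  uniform-below zero    refl = uniform-top
  uniform-below (suc d) {j} e = uniform-pred (ℕ.<-≤-trans j<t t≤n)
    (uniform-below d (trans (ℕ.+-suc d j) e))
    where
    j<t : j < t
    j<t = subst (j <_) e (s≤s (ℕ.m≤n+m j d))

  uniform : ∀ {j} → j ≤ t → Uniform j
  uniform {j} j≤t = uniform-below (t ℕ.∸ j) (ℕ.m∸n+n≡m j≤t)

  size : ℤ
  size = + length ws

  Q : ℤ
  Q = + q

  -- By uniformity the `q` extensions to a new column have equal counts, so each column divides the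
  -- count by `q`. Powers of `Q` are kept on the left to avoid fractions.
  count-value : ∀ {j} (is : Vec (Fin n) j) u → Unique (toList is) → j ≤ t → Q ^ j * count is u ≡ size
  count-value []       []      _          _   = trans (*-identityˡ _) (trans (∑-const 1ℤ ws) (*-identityʳ size))
  count-value {suc j} (i ∷ is) (s ∷ u) un@(_ ∷ un') j≤t = begin
    Q * Q ^ j * count (i ∷ is) (s ∷ u)    ≡⟨ lemma Q (Q ^ j) _ ⟩
    Q ^ j * (Q * count (i ∷ is) (s ∷ u))  ≡⟨ cong (λ k → Q ^ j * (+ k * count (i ∷ is) (s ∷ u))) (length-tabulate {n = q} (λ s → s)) ⟨
    Q ^ j * (+ length (allFin q) * count (i ∷ is) (s ∷ u))  ≡⟨ cong (Q ^ j *_) (∑-const _ (allFin q)) ⟨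
    Q ^ j * ∑ (allFin q) (λ _ → count (i ∷ is) (s ∷ u))
      ≡⟨ cong (Q ^ j *_) (∑-cong (allFin q) (λ s' → uniform j≤t (i ∷ is) un (s ∷ u) (s' ∷ u))) ⟩
    Q ^ j * ∑ (allFin q) (λ s' → count (i ∷ is) (s' ∷ u))  ≡⟨ cong (Q ^ j *_) (count-extend is u i) ⟨
    Q ^ j * count is u                    ≡⟨ count-value is u un' (ℕ.<⇒≤ j≤t) ⟩
    size                                  ∎
    where
    open ≡-Reasoning
    lemma : ∀ a b c → a * b * c ≡ b * (a * c)
    lemma = solve-∀

  -- The falling factorial counts ordered `k`-tuples of columns of `L` in which `y` agrees with `x`.
  -- By `fall-δ`, the first column of `L` either stays out of the tuple or becomes one more
  -- prescribed column while `k` drops by one; thus `j + k` never grows beyond the strength.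
  moment-on : ∀ (x : Word n q) L {j} (is : Vec (Fin n) j) u k → Unique (toList is ++ L) → j ℕ.+ k ≤ t →
    Q ^ (j ℕ.+ k) * ∑ ws (λ y → ind is u y * fall k (agree L x y)) ≡ size * fall k (+ length L)
  moment-on x L {j} is u zero un j≤t = begin
    Q ^ (j ℕ.+ 0) * ∑ ws (λ y → ind is u y * 1ℤ)
      ≡⟨ cong₂ (λ a b → Q ^ a * b) (ℕ.+-identityʳ j) (∑-cong ws (λ y → *-identityʳ _)) ⟩
    Q ^ j * count is u   ≡⟨ count-value is u (Unique-++⁻ˡ (toList is) un) (subst (_≤ t) (ℕ.+-identityʳ j) j≤t) ⟩
    size                 ≡⟨ *-identityʳ size ⟨
    size * 1ℤ            ∎
    where open ≡-Reasoning
  moment-on x [] {j} is u (suc k) un j≤t = begin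
    Q ^ (j ℕ.+ suc k) * ∑ ws (λ y → ind is u y * (0ℤ * fall k (0ℤ - 1ℤ)))
      ≡⟨ cong (Q ^ (j ℕ.+ suc k) *_) (∑-zero ws (λ {y} _ → *-zeroʳ (ind is u y))) ⟩
    Q ^ (j ℕ.+ suc k) * 0ℤ   ≡⟨ *-zeroʳ (Q ^ (j ℕ.+ suc k)) ⟩
    0ℤ                       ≡⟨ *-zeroʳ size ⟨
    size * 0ℤ                ∎
    where open ≡-Reasoning
  moment-on x (i ∷ L) {j} is u (suc k) un j≤t = begin
    Q ^ (j ℕ.+ suc k) * ∑ ws (λ y → ind is u y * fall (suc k) (δ (lookup y i) (lookup x i) + agree L x y))
      ≡⟨ cong (Q ^ (j ℕ.+ suc k) *_) (∑-cong ws (λ y → begin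
           ind is u y * fall (suc k) (δ (lookup y i) (lookup x i) + agree L x y)
             ≡⟨ cong (ind is u y *_) (fall-δ k (lookup y i) (lookup x i) (agree L x y)) ⟩
           ind is u y * (fall (suc k) (agree L x y) + K * (δ (lookup y i) (lookup x i) * fall k (agree L x y)))
             ≡⟨ distribute (ind is u y) _ K (δ (lookup y i) (lookup x i)) _ ⟩
           A y + K * B y ∎)) ⟩
    Q ^ (j ℕ.+ suc k) * ∑ ws (λ y → A y + K * B y)
      ≡⟨ cong (Q ^ (j ℕ.+ suc k) *_) (trans (∑-+ ws A _) (cong (λ r → ∑ ws A + r) (∑-*ˡ K ws B))) ⟩
    Q ^ (j ℕ.+ suc k) * (∑ ws A + K * ∑ ws B)
      ≡⟨ distribute′ (Q ^ (j ℕ.+ suc k)) (∑ ws A) K (∑ ws B) ⟩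
    Q ^ (j ℕ.+ suc k) * ∑ ws A + K * (Q ^ (j ℕ.+ suc k) * ∑ ws B)
      ≡⟨ cong₂ (λ a b → a + K * b)
           (moment-on x L is u (suc k) (drop-head un′) j≤t)
           (trans (cong (λ e → Q ^ e * ∑ ws B) (ℕ.+-suc j k))
                    (moment-on x L (i ∷ is) (lookup x i ∷ u) k un′ (subst (_≤ t) (ℕ.+-suc j k) j≤t))) ⟩
    size * fall (suc k) (+ length L) + K * (size * fall k (+ length L))
      ≡⟨ collect size (fall (suc k) (+ length L)) K (fall k (+ length L)) ⟩
    size * (fall (suc k) (+ length L) + K * fall k (+ length L))
      ≡⟨ cong (size *_) (fall-suc k (+ length L)) ⟨
    size * fall (suc k) (+ suc (length L)) ∎
    where
    open ≡-Reasoning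
    K = + suc k
    A B : Word n q → ℤ
    A y = ind is u y * fall (suc k) (agree L x y)
    B y = ind (i ∷ is) (lookup x i ∷ u) y * fall k (agree L x y)
    un′ : Unique (i ∷ toList is ++ L)
    un′ = Unique-resp-↭ (shift i (toList is) L) un
    drop-head : ∀ {xs : List (Fin n)} {i} → Unique (i ∷ xs) → Unique xs
    drop-head (_ ∷ p) = p
    distribute : ∀ a f K d g → a * (f + K * (d * g)) ≡ a * f + K * (d * a * g)
    distribute = solve-∀
    distribute′ : ∀ p a K b → p * (a + K * b) ≡ p * a + K * (p * b)
    distribute′ = solve-∀
    collect : ∀ s a K b → s * a + K * (s * b) ≡ s * (a + K * b)
    collect = solve-∀

  agreement : Word n q → Word n q → ℤ
  agreement = agree (allFin n)

  Avoids : ∀ {j} → Vec (Fin n) j → Vec (Fin q) j → Word n q → Set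
  Avoids is u x = ∀ t → lookup u t ≢ lookup x (lookup is t)

  -- A word selected by the indicator differs from `x` in all columns `is`, so its agreements with
  -- `x` all lie in the other `n - j` columns.
  moment : ∀ x {j} (is : Vec (Fin n) j) u k → Unique (toList is) → Avoids is u x → j ℕ.+ k ≤ t →
    Q ^ (j ℕ.+ k) * ∑ ws (λ y → ind is u y * fall k (agreement x y)) ≡ size * fall k (+ n - + j)
  moment x {j} is u k un av j≤t with L , r , e ← complement-columns is un = begin
    Q ^ (j ℕ.+ k) * ∑ ws (λ y → ind is u y * fall k (agreement x y))
      ≡⟨ cong (Q ^ (j ℕ.+ k) *_) (∑-cong ws pointwise) ⟩
    Q ^ (j ℕ.+ k) * ∑ ws (λ y → ind is u y * fall k (agree L x y))
      ≡⟨ moment-on x L is u k (Unique-resp-↭ r (allFin⁺ n)) j≤t ⟩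
    size * fall k (+ length L)
      ≡⟨ cong (λ z → size * fall k z) (trans (cancel-+ (+ j) (+ length L)) (cong (λ m → + m - + j) (sym e))) ⟩
    size * fall k (+ n - + j) ∎
    where
    open ≡-Reasoning
    cancel-+ : ∀ a b → b ≡ a + b - a
    cancel-+ = solve-∀
    none : ∀ y {j} (is : Vec (Fin n) j) u → (∀ t → lookup y (lookup is t) ≡ lookup u t) → Avoids is u x → agree (toList is) x y ≡ 0ℤ
    none y []       []      _ _  = refl
    none y (i ∷ is) (s ∷ u) m av = cong₂ _+_ (δ-neq λ e → av zero (trans (sym (m zero)) e)) (none y is u (m ∘ suc) (av ∘ suc))
    pointwise : ∀ y → ind is u y * fall k (agreement x y) ≡ ind is u y * fall k (agree L x y)
    pointwise y with ind≡0⊎match is u y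
    ... | inj₁ z rewrite z = refl
    ... | inj₂ m = cong (λ z → ind is u y * fall k z) (begin
      agreement x y                            ≡⟨ ∑-↭ _ r ⟩
      agree (toList is ++ L) x y               ≡⟨ ∑-++ (toList is) L _ ⟩
      agree (toList is) x y + agree L x y      ≡⟨ cong (_+ agree L x y) (none y is u m av) ⟩
      0ℤ + agree L x y                         ≡⟨ +-identityˡ _ ⟩
      agree L x y                              ∎)

  -- Polynomials are given by their coefficients in the basis of falling factorials, leading coefficient first.
  eval : ∀ {m} → Vec ℤ m → ℤ → ℤ
  eval []           z = 0ℤ
  eval {suc k} (c ∷ cs) z = c * fall k z + eval cs z

  -- Horner form of the polynomial with each `fall k z` replaced by `fall k z` divided by `Q ^ k`,
  -- the whole multiplied by `Q ^ m` to clear denominators.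
  mean : ∀ {m} → Vec ℤ m → ℤ → ℤ
  mean []           z = 0ℤ
  mean {suc k} (c ∷ cs) z = Q * (c * fall k z + mean cs z)

  -- Linear extension of `moment`. The vector `cs` of length `m` stands for degree at most `m - 1`,
  -- whence the bound by `suc t`.
  poly-moment : ∀ x {j} (is : Vec (Fin n) j) u → Unique (toList is) → Avoids is u x →
    ∀ {m} (cs : Vec ℤ m) → j ℕ.+ m ≤ suc t →
    Q ^ (j ℕ.+ m) * ∑ ws (λ y → ind is u y * eval cs (agreement x y)) ≡ size * mean cs (+ n - + j)
  poly-moment x {j} is u un av [] _ = trans
    (cong (Q ^ (j ℕ.+ 0) *_) (∑-zero ws (λ {y} _ → *-zeroʳ (ind is u y))))
    (trans (*-zeroʳ (Q ^ (j ℕ.+ 0))) (sym (*-zeroʳ size)))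
  poly-moment x {j} is u un av {suc k} (c ∷ cs) b = begin
    Q ^ (j ℕ.+ suc k) * ∑ ws (λ y → ind is u y * (c * fall k (z y) + eval cs (z y)))
      ≡⟨ cong₂ _*_ (cong (Q ^_) (ℕ.+-suc j k)) (trans
           (∑-cong ws (λ y → distribute (ind is u y) c (fall k (z y)) (eval cs (z y))))
           (trans (∑-+ ws (λ y → c * A y) B) (cong (_+ ∑ ws B) (∑-*ˡ c ws A)))) ⟩
    Q * Q ^ (j ℕ.+ k) * (c * ∑ ws A + ∑ ws B)
      ≡⟨ split Q (Q ^ (j ℕ.+ k)) c (∑ ws A) (∑ ws B) ⟩
    Q * (c * (Q ^ (j ℕ.+ k) * ∑ ws A) + Q ^ (j ℕ.+ k) * ∑ ws B)
      ≡⟨ cong₂ (λ a b → Q * (c * a + b)) (moment x is u k un av b′) (poly-moment x is u un av cs (ℕ.m≤n⇒m≤1+n b′)) ⟩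
    Q * (c * (size * fall k M) + size * mean cs M)
      ≡⟨ collect Q c size (fall k M) (mean cs M) ⟩
    size * (Q * (c * fall k M + mean cs M)) ∎
    where
    open ≡-Reasoning
    z : Word n q → ℤ
    z = agreement x
    M = + n - + j
    A B : Word n q → ℤ
    A y = ind is u y * fall k (z y)
    B y = ind is u y * eval cs (z y)
    b′ : j ℕ.+ k ≤ t
    b′ = ℕ.s≤s⁻¹ (subst (_≤ suc t) (ℕ.+-suc j k) b)
    distribute : ∀ i c f e → i * (c * f + e) ≡ c * (i * f) + i * e
    distribute = solve-∀
    split : ∀ Q p c a b → Q * p * (c * a + b) ≡ Q * (c * (p * a) + p * b)
    split = solve-∀
    collect : ∀ Q c s f m → Q * (c * (s * f) + s * m) ≡ s * (Q * (c * f + m))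
    collect = solve-∀

-- The parameters n and q

agree-∷ : ∀ {n q} (a b : Fin q) (x y : Word n q) →
  agree (allFin (suc n)) (a ∷ x) (b ∷ y) ≡ δ b a + agree (allFin n) x y
agree-∷ {n} a b x y = cong (λ s → δ b a + s) (∑-tabulate {m = n} suc (λ i → δ (lookup (b ∷ y) i) (lookup (a ∷ x) i)))

dist+agreement : ∀ {n q} (x y : Word n q) → + dist x y + agree (allFin n) x y ≡ + n
dist+agreement []      []      = refl
dist+agreement {suc n} (a ∷ x) (b ∷ y) with a ≟ b
... | yes e = begin
  + dist x y + agree (allFin (suc n)) (a ∷ x) (b ∷ y)  ≡⟨ cong (λ s → + dist x y + s) (agree-∷ a b x y) ⟩
  + dist x y + (δ b a + agree (allFin n) x y)      ≡⟨ cong (λ d → + dist x y + (d + agree (allFin n) x y)) (δ-eq (sym e)) ⟩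
  + dist x y + (1ℤ + agree (allFin n) x y)         ≡⟨ lemma (+ dist x y) (agree (allFin n) x y) ⟩
  1ℤ + (+ dist x y + agree (allFin n) x y)         ≡⟨ cong (λ s → 1ℤ + s) (dist+agreement x y) ⟩
  + suc n                                          ∎
  where
  open ≡-Reasoning
  lemma : ∀ d g → d + (1ℤ + g) ≡ 1ℤ + (d + g)
  lemma = solve-∀
... | no ne = begin
  + suc (dist x y) + agree (allFin (suc n)) (a ∷ x) (b ∷ y)  ≡⟨ cong (λ s → + suc (dist x y) + s) (agree-∷ a b x y) ⟩
  + suc (dist x y) + (δ b a + agree (allFin n) x y)  ≡⟨ cong (λ d → + suc (dist x y) + (d + agree (allFin n) x y)) (δ-neq (ne ∘ sym)) ⟩
  1ℤ + + dist x y + (0ℤ + agree (allFin n) x y)      ≡⟨ lemma (+ dist x y) (agree (allFin n) x y) ⟩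
  1ℤ + (+ dist x y + agree (allFin n) x y)           ≡⟨ cong (λ s → 1ℤ + s) (dist+agreement x y) ⟩
  + suc n                                            ∎
  where
  open ≡-Reasoning
  lemma : ∀ d g → 1ℤ + d + (0ℤ + g) ≡ 1ℤ + (d + g)
  lemma = solve-∀

dist-self : ∀ {n q} (x : Word n q) → dist x x ≡ 0
dist-self []      = refl
dist-self (a ∷ x) with a ≟ a
... | yes _ = dist-self x
... | no ne = ⊥-elim (ne refl)

agreement-self : ∀ {n q} (x : Word n q) → agree (allFin n) x x ≡ + n
agreement-self {n} x = trans (sym (+-identityˡ _))
  (trans (cong (λ d → + d + agree (allFin n) x x) (sym (dist-self x))) (dist+agreement x x))

other : ∀ {q} → 2 ≤ q → (s : Fin q) → ∃[ s' ] s' ≢ s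
other (s≤s (s≤s _)) zero    = suc zero , λ ()
other (s≤s (s≤s _)) (suc s) = zero , λ ()

distinct-columns : ∀ {n} j → j ≤ n → Σ (Vec (Fin n) j) (Unique ∘ toList)
distinct-columns zero    _   = [] , []
distinct-columns (suc j) j<n =
  let is , un = distinct-columns j (ℕ.<⇒≤ j<n)
      i , un' = fresh is un j<n
  in i ∷ is , un'

cancel : ∀ i {j} → i ≢ 0ℤ → i * j ≡ 0ℤ → j ≡ 0ℤ
cancel i ne e with i*j≡0⇒i≡0∨j≡0 i e
... | inj₁ z = ⊥-elim (ne z)
... | inj₂ z = z

cancel₂ : ∀ i {j k} → i ≢ 0ℤ → i * j ≡ i * k → j ≡ k
cancel₂ i {j} {k} ne e = i-j≡0⇒i≡j j k (cancel i ne (trans (lemma i j k) (i≡j⇒i-j≡0 e)))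
  where
  lemma : ∀ i j k → i * (j - k) ≡ i * j - i * k
  lemma = solve-∀

-- Identities for the quartic and the cubic in the number of agreements.

module Identities where

  -- z h(z) in the basis of falling factorials, where h(z) = (z - ν)((z - ν)² - μ²).
  c₂ c₁ c₀ : ℤ → ℤ → ℤ
  c₂ ν μ = + 6 - + 3 * ν
  c₁ ν μ = + 3 * (ν - 1ℤ) * (ν - 1ℤ) - + 3 * (ν - 1ℤ) + 1ℤ - μ * μ
  c₀ ν μ = (ν - 1ℤ) * (μ * μ - (ν - 1ℤ) * (ν - 1ℤ))

  -- For this quartic and M coordinates, mean = Q M p(M).
  p : ℤ → ℤ → ℤ → ℤ → ℤ
  p ν μ Q M = (M - + 1) * (M - + 2) * (M - + 3) + Q * (c₂ ν μ * (M - + 1) * (M - + 2) + Q * (c₁ ν μ * (M - + 1) + Q * c₀ ν μ))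

  quartic-eval : ∀ ν μ z →
    let f₁ = z * 1ℤ
        f₂ = z * ((z - 1ℤ) * 1ℤ)
        f₃ = z * ((z - 1ℤ) * ((z - 1ℤ - 1ℤ) * 1ℤ))
        f₄ = z * ((z - 1ℤ) * ((z - 1ℤ - 1ℤ) * ((z - 1ℤ - 1ℤ - 1ℤ) * 1ℤ)))
    in 1ℤ * f₄ + ((+ 6 - + 3 * ν) * f₃ + ((+ 3 * (ν - 1ℤ) * (ν - 1ℤ) - + 3 * (ν - 1ℤ) + 1ℤ - μ * μ) * f₂ + ((ν - 1ℤ) * (μ * μ - (ν - 1ℤ) * (ν - 1ℤ)) * f₁ + (0ℤ * 1ℤ + 0ℤ))))
     ≡ z * (z - ν) * ((z - ν) * (z - ν) - μ * μ)
  quartic-eval = solve-∀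

  quartic-mean : ∀ Q c₂ c₁ c₀ M →
    let f₁ = M * 1ℤ
        f₂ = M * ((M - 1ℤ) * 1ℤ)
        f₃ = M * ((M - 1ℤ) * ((M - 1ℤ - 1ℤ) * 1ℤ))
        f₄ = M * ((M - 1ℤ) * ((M - 1ℤ - 1ℤ) * ((M - 1ℤ - 1ℤ - 1ℤ) * 1ℤ)))
    in Q * (1ℤ * f₄ + Q * (c₂ * f₃ + Q * (c₁ * f₂ + Q * (c₀ * f₁ + Q * (0ℤ * 1ℤ + 0ℤ)))))
     ≡ Q * (M * ((M - + 1) * (M - + 2) * (M - + 3) + Q * (c₂ * (M - + 1) * (M - + 2) + Q * (c₁ * (M - + 1) + Q * c₀))))
  quartic-mean = solve-∀

  -- The second difference removes the terms with `c₁` and `c₀`, which are at most linear in `M`.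
  -- Zeros of `p` at n - 1, n - 2 and n - 3 therefore force `Q` to be 2.
  second-difference : ∀ ν Q c₁ c₀ →
    let p = λ M → (M - + 1) * (M - + 2) * (M - + 3) + Q * ((+ 6 - + 3 * ν) * (M - + 1) * (M - + 2) + Q * (c₁ * (M - + 1) + Q * c₀))
        n = ν + ν
    in p (n - + 1) - + 2 * p (n - + 2) + p (n - + 3) ≡ (ν - + 2) * (+ 6 * (+ 2 - Q))
  second-difference = solve-∀

  -- With `Q` equal to 2 the constant term cancels. Since n = 2ν and n - 2a = 2μ, its vanishing is
  -- the relation 3n = (n - 2a)² + 8.
  first-difference : ∀ ν μ →
    let p = λ M → (M - + 1) * (M - + 2) * (M - + 3) + + 2 * ((+ 6 - + 3 * ν) * (M - + 1) * (M - + 2) + + 2 * ((+ 3 * (ν - 1ℤ) * (ν - 1ℤ) - + 3 * (ν - 1ℤ) + 1ℤ - μ * μ) * (M - + 1) + + 2 * ((ν - 1ℤ) * (μ * μ - (ν - 1ℤ) * (ν - 1ℤ)))))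
        n = ν + ν
    in p (n - + 2) - p (n - + 3) ≡ + 2 * (+ 3 * ν - (+ 2 * (μ * μ) + + 4))
  first-difference = solve-∀

  -- The third difference of a monic cubic is 3!. Together with the three zeros it gives the value
  -- of `p` at n.
  third-difference : ∀ ν c₁ c₀ →
    let p = λ M → (M - + 1) * (M - + 2) * (M - + 3) + + 2 * ((+ 6 - + 3 * ν) * (M - + 1) * (M - + 2) + + 2 * (c₁ * (M - + 1) + + 2 * c₀))
        n = ν + ν
    in p (n - + 0) - + 3 * p (n - + 1) + + 3 * p (n - + 2) - p (n - + 3) ≡ + 6
  third-difference = solve-∀

  -- Dropping the root ν + μ from the quartic leaves a cubic that detects only distance `a` among
  -- the nonzero distances.
  cubic-eval : ∀ ν μ z →
    let f₁ = z * 1ℤ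
        f₂ = z * ((z - 1ℤ) * 1ℤ)
        f₃ = z * ((z - 1ℤ) * ((z - 1ℤ - 1ℤ) * 1ℤ))
    in 1ℤ * f₃ + ((+ 3 + μ - + 2 * ν) * f₂ + ((ν - 1ℤ) * (ν - 1ℤ - μ) * f₁ + (0ℤ * 1ℤ + 0ℤ)))
     ≡ z * (z - ν) * (z - ν + μ)
  cubic-eval = solve-∀

  cubic-mean : ∀ ν μ →
    let M = ν + ν - + 0
        f₁ = M * 1ℤ
        f₂ = M * ((M - 1ℤ) * 1ℤ)
        f₃ = M * ((M - 1ℤ) * ((M - 1ℤ - 1ℤ) * 1ℤ))
    in + 2 * (1ℤ * f₃ + + 2 * ((+ 3 + μ - + 2 * ν) * f₂ + + 2 * ((ν - 1ℤ) * (ν - 1ℤ - μ) * f₁ + + 2 * (0ℤ * 1ℤ + 0ℤ))))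
     ≡ + 8 * (ν + μ) * ν
  cubic-mean = solve-∀

  -- Modulo `w`, `T` is 4, so the right-hand side is 16 · (32 - 27) = 80, while the left-hand side
  -- is 0. The long polynomial is the explicit quotient.
  80≡multiple : ∀ w B T → + 81 * (+ 3 * (w * B)) ≡ T * T * (+ 2 * (T * T) - + 18 * w - + 27) → T ≡ + 2 * w + + 4 →
    + 80 ≡ w * (+ 243 * B - (+ 32 * (w * w * w) + + 184 * (w * w) + + 372 * w + + 304))
  80≡multiple w B T e refl = trans (lemma₁ w) (trans (cong (λ s → s - (+ 32 * (w * w * w) + + 184 * (w * w) + + 372 * w + + 304) * w) (sym e)) (lemma₂ w B))
    where
    lemma₁ : ∀ w → let T = + 2 * w + + 4 in + 80 ≡ T * T * (+ 2 * (T * T) - + 18 * w - + 27) - (+ 32 * (w * w * w) + + 184 * (w * w) + + 372 * w + + 304) * w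
    lemma₁ = solve-∀
    lemma₂ : ∀ w B → + 81 * (+ 3 * (w * B)) - (+ 32 * (w * w * w) + + 184 * (w * w) + + 372 * w + + 304) * w ≡ w * (+ 243 * B - (+ 32 * (w * w * w) + + 184 * (w * w) + + 372 * w + + 304))
    lemma₂ = solve-∀

  -- Eliminates `size` between the two formulas and applies `80≡multiple` with `w` = m² and `T` =
  -- 3N. Multiplying by 81 turns powers of N up to the fourth into powers of `T`.
  square-divides-80ℤ : ∀ N m B size → + 4 * (N * N) + + 4 * (m * m * B) ≡ size * N →
    + 8 * (N * (N * N - m * m)) ≡ + 3 * size → + 3 * N ≡ + 2 * (m * m) + + 4 → ∃[ X ] + 80 ≡ m * m * X
  square-divides-80ℤ N m B size e size-formula 3N≡ = _ , 80≡multiple (m * m) B (+ 3 * N) premise 3N≡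
    where
    open ≡-Reasoning
    premise : + 81 * (+ 3 * (m * m * B)) ≡ (+ 3 * N) * (+ 3 * N) * (+ 2 * ((+ 3 * N) * (+ 3 * N)) - + 18 * (m * m) - + 27)
    premise = cancel₂ (+ 4) (λ ()) (begin
      + 4 * (+ 81 * (+ 3 * (m * m * B)))
        ≡⟨ lemma₁ N m B ⟩
      + 81 * (+ 3 * (+ 4 * (N * N) + + 4 * (m * m * B)) - + 12 * (N * N))
        ≡⟨ cong (λ s → + 81 * (+ 3 * s - + 12 * (N * N))) e ⟩
      + 81 * (+ 3 * (size * N) - + 12 * (N * N))
        ≡⟨ lemma₂ N size ⟩
      + 81 * (+ 3 * size * N - + 12 * (N * N))
        ≡⟨ cong (λ s → + 81 * (s * N - + 12 * (N * N))) size-formula ⟨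
      + 81 * (+ 8 * (N * (N * N - m * m)) * N - + 12 * (N * N))
        ≡⟨ lemma₃ N m ⟩
      + 4 * ((+ 3 * N) * (+ 3 * N) * (+ 2 * ((+ 3 * N) * (+ 3 * N)) - + 18 * (m * m) - + 27)) ∎)
      where
      lemma₁ : ∀ N m B → + 4 * (+ 81 * (+ 3 * (m * m * B))) ≡ + 81 * (+ 3 * (+ 4 * (N * N) + + 4 * (m * m * B)) - + 12 * (N * N))
      lemma₁ = solve-∀
      lemma₂ : ∀ N s → + 81 * (+ 3 * (s * N) - + 12 * (N * N)) ≡ + 81 * (+ 3 * s * N - + 12 * (N * N))
      lemma₂ = solve-∀
      lemma₃ : ∀ N m → + 81 * (+ 8 * (N * (N * N - m * m)) * N - + 12 * (N * N)) ≡ + 4 * ((+ 3 * N) * (+ 3 * N) * (+ 2 * ((+ 3 * N) * (+ 3 * N)) - + 18 * (m * m) - + 27))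
      lemma₃ = solve-∀

length≢0 : ∀ {A : Set} {x : A} {xs} → x ∈ xs → + length xs ≢ 0ℤ
length≢0 (here _)  ()
length≢0 (there _) ()

square-divides-80 : ∀ μ → μ ≢ 0 → μ ℕ.* μ ℕ.∣ 80 → μ ≡ 1 ⊎ μ ≡ 2 ⊎ μ ≡ 4
square-divides-80 0 ne _ = ⊥-elim (ne refl)
square-divides-80 1 _ _ = inj₁ refl
square-divides-80 2 _ _ = inj₂ (inj₁ refl)
square-divides-80 3 _ d = ⊥-elim (from-no (9 ℕ.∣? 80) d)
square-divides-80 4 _ _ = inj₂ (inj₂ refl)
square-divides-80 5 _ d = ⊥-elim (from-no (25 ℕ.∣? 80) d)
square-divides-80 6 _ d = ⊥-elim (from-no (36 ℕ.∣? 80) d)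
square-divides-80 7 _ d = ⊥-elim (from-no (49 ℕ.∣? 80) d)
square-divides-80 8 _ d = ⊥-elim (from-no (64 ℕ.∣? 80) d)
square-divides-80 (suc (suc (suc (suc (suc (suc (suc (suc (suc k))))))))) _ d =
  ⊥-elim (ℕ.<⇒≱ (ℕ.*-mono-≤ (ℕ.m≤m+n 9 k) (ℕ.m≤m+n 9 k)) (ℕ.∣⇒≤ d))

-- `ν` is n/2 and `μ` is n/2 - a. In terms of agreements, the distances a, n/2, n - a, n become ν +
-- μ, ν, ν - μ, 0, symmetric about ν apart from the last.
module Parameters {n q : ℕ} (C : Code n q) (8≤n : 8 ≤ n) (2≤q : 2 ≤ q) (design : IsDesign 7 C)
  (ν a μ : ℕ) (n≡ν+ν : n ≡ ν ℕ.+ ν) (ν≡a+μ : ν ≡ a ℕ.+ μ) (μ≢0 : μ ≢ 0)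
  (degrees : ∀ {x y} → x ∈C C → y ∈C C → x ≢ y →
     dist x y ≡ a ⊎ dist x y ≡ ν ⊎ dist x y ≡ n ℕ.∸ a ⊎ dist x y ≡ n) where

  open Identities
  open Design C 7 (ℕ.≤-trans (ℕ.m≤m+n 7 1) 8≤n) design

  N m : ℤ
  N = + ν
  m = + μ

  n≡N+N : + n ≡ N + N
  n≡N+N = trans (cong +_ n≡ν+ν) (pos-+ ν ν)

  n≡a+ν+μ : n ≡ a ℕ.+ (ν ℕ.+ μ)
  n≡a+ν+μ = trans n≡ν+ν (trans (cong (ℕ._+ ν) ν≡a+μ) (trans (ℕ.+-assoc a μ ν) (cong (a ℕ.+_) (ℕ.+-comm μ ν))))

  agreement-at : ∀ x y {d} w → dist x y ≡ d → + n ≡ + d + w → agreement x y ≡ w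
  agreement-at x y w refl e = cancel-+ (+ dist x y) (trans (dist+agreement x y) e)
    where
    cancel-+ : ∀ d {z w} → d + z ≡ d + w → z ≡ w
    cancel-+ d {z} {w} e = trans (sym (lemma d z)) (trans (cong (λ s → s - d) e) (lemma d w))
      where
      lemma : ∀ d z → d + z - d ≡ z
      lemma = solve-∀

  agreements : ∀ {x y} → x ∈ ws → y ∈ ws → x ≢ y →
    let z = agreement x y in z ≡ N + m ⊎ z ≡ N ⊎ z ≡ N - m ⊎ z ≡ 0ℤ
  agreements {x} {y} x∈ y∈ x≢y with degrees x∈ y∈ x≢y
  ... | inj₁ e = inj₁ (agreement-at x y (N + m) e (trans (cong +_ n≡a+ν+μ) (trans (pos-+ a (ν ℕ.+ μ)) (cong (λ s → + a + s) (pos-+ ν μ)))))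
  ... | inj₂ (inj₁ e) = inj₂ (inj₁ (agreement-at x y N e n≡N+N))
  ... | inj₂ (inj₂ (inj₁ e)) = inj₂ (inj₂ (inj₁ (agreement-at x y {n ℕ.∸ a} (N - m) e
          (trans n≡N+N (trans (lemma N m) (cong (λ s → s + (N - m)) (trans (sym (pos-+ ν μ)) (cong +_ (sym (trans (cong (ℕ._∸ a) n≡a+ν+μ) (ℕ.m+n∸m≡n a (ν ℕ.+ μ)))))))))))) 
    where
    lemma : ∀ N m → N + N ≡ N + m + (N - m)
    lemma = solve-∀
  ... | inj₂ (inj₂ (inj₂ e)) = inj₂ (inj₂ (inj₂ (agreement-at x y 0ℤ e (sym (+-identityʳ (+ n))))))

  x₀ : Word n q
  x₀ = proj₁ (proj₁ design)

  x₀∈ : x₀ ∈ ws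
  x₀∈ = proj₂ (proj₁ design)

  quarticPoly : Vec ℤ 5
  quarticPoly = 1ℤ ∷ c₂ N m ∷ c₁ N m ∷ c₀ N m ∷ 0ℤ ∷ []

  quartic-vanishes : ∀ {y} → y ∈ ws → x₀ ≢ y → eval quarticPoly (agreement x₀ y) ≡ 0ℤ
  quartic-vanishes {y} y∈ ne = trans (quartic-eval N m (agreement x₀ y)) (root (agreements x₀∈ y∈ ne))
    where
    root : ∀ {z} → z ≡ N + m ⊎ z ≡ N ⊎ z ≡ N - m ⊎ z ≡ 0ℤ → z * (z - N) * ((z - N) * (z - N) - m * m) ≡ 0ℤ
    root (inj₁ refl) = lemma N m
      where
      lemma : ∀ N m → let z = N + m in z * (z - N) * ((z - N) * (z - N) - m * m) ≡ 0ℤ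
      lemma = solve-∀
    root (inj₂ (inj₁ refl)) = lemma N m
      where
      lemma : ∀ N m → let z = N in z * (z - N) * ((z - N) * (z - N) - m * m) ≡ 0ℤ
      lemma = solve-∀
    root (inj₂ (inj₂ (inj₁ refl))) = lemma N m
      where
      lemma : ∀ N m → let z = N - m in z * (z - N) * ((z - N) * (z - N) - m * m) ≡ 0ℤ
      lemma = solve-∀
    root (inj₂ (inj₂ (inj₂ refl))) = refl

  -- The `j` prescribed columns disagree with `x₀`. As `j` is positive, this excludes `x₀` itself,
  -- and the quartic vanishes at every other codeword. Degree 4 with three columns exhausts strength
  -- 7.
  mean-quartic-vanishes : ∀ j → 1 ≤ j → j ≤ 3 → mean quarticPoly (N + N - + j) ≡ 0ℤ
  mean-quartic-vanishes j 1≤j j≤3 = cancel size (length≢0 x₀∈) (begin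
    size * mean quarticPoly (N + N - + j)   ≡⟨ cong (λ s → size * mean quarticPoly (s - + j)) n≡N+N ⟨
    size * mean quarticPoly (+ n - + j)     ≡⟨ poly-moment x₀ is u un avoids quarticPoly (ℕ.+-monoˡ-≤ 5 j≤3) ⟨
    Q ^ (j ℕ.+ 5) * ∑ ws (λ y → ind is u y * eval quarticPoly (agreement x₀ y))
      ≡⟨ cong (Q ^ (j ℕ.+ 5) *_) (∑-zero ws vanish) ⟩
    Q ^ (j ℕ.+ 5) * 0ℤ                      ≡⟨ *-zeroʳ (Q ^ (j ℕ.+ 5)) ⟩
    0ℤ                                      ∎)
    where
    open ≡-Reasoning
    chosen = distinct-columns {n} j (ℕ.≤-trans j≤3 (ℕ.≤-trans (ℕ.m≤m+n 3 5) 8≤n))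
    is = proj₁ chosen
    un = proj₂ chosen
    u : Vec (Fin q) j
    u = Vec.map (λ i → proj₁ (other 2≤q (lookup x₀ i))) is
    avoids : Avoids is u x₀
    avoids t e = proj₂ (other 2≤q (lookup x₀ (lookup is t))) (trans (sym (lookup-map t _ is)) e)
    column : Fin j
    column = fromℕ< 1≤j
    vanish : ∀ {y} → y ∈ ws → ind is u y * eval quarticPoly (agreement x₀ y) ≡ 0ℤ
    vanish {y} y∈ with ind≡0⊎match is u y
    ... | inj₁ z = trans (cong (_* eval quarticPoly (agreement x₀ y)) z) (*-zeroˡ (eval quarticPoly (agreement x₀ y)))
    ... | inj₂ match = trans (cong (ind is u y *_) (quartic-vanishes y∈ λ { refl → avoids column (sym (match column)) })) (*-zeroʳ (ind is u y))

  Q≢0 : Q ≢ 0ℤ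
  Q≢0 e = ℕ.n≮0 (subst (2 ≤_) (+-injective e) 2≤q)

  M≢0 : ∀ j → j ≤ 3 → N + N - + j ≢ 0ℤ
  M≢0 j j≤3 e with refl ← +-injective (trans n≡N+N (i-j≡0⇒i≡j (N + N) (+ j) e)) = ℕ.<⇒≱ (s≤s j≤3) (ℕ.≤-trans (ℕ.m≤m+n 4 4) 8≤n)

  p-vanishes : ∀ j → 1 ≤ j → j ≤ 3 → p N m Q (N + N - + j) ≡ 0ℤ
  p-vanishes j 1≤j j≤3 = cancel (N + N - + j) (M≢0 j j≤3) (cancel Q Q≢0
    (trans (sym (quartic-mean Q (c₂ N m) (c₁ N m) (c₀ N m) (N + N - + j))) (mean-quartic-vanishes j 1≤j j≤3)))

  4≤ν : 4 ≤ ν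
  4≤ν with ν ℕ.≤? 3
  ... | yes ν≤3 = ⊥-elim (ℕ.<⇒≱ (ℕ.≤-trans (s≤s (ℕ.+-mono-≤ ν≤3 ν≤3)) (ℕ.m≤m+n 7 1)) (subst (8 ≤_) n≡ν+ν 8≤n))
  ... | no  ν≰3 = ℕ.≰⇒> ν≰3

  N≢2 : N - + 2 ≢ 0ℤ
  N≢2 e = ℕ.<⇒≱ (ℕ.m≤m+n 3 1) (subst (4 ≤_) (+-injective (i-j≡0⇒i≡j N (+ 2) e)) 4≤ν)

  Q≡2 : Q ≡ + 2
  Q≡2 = sym (i-j≡0⇒i≡j (+ 2) Q (cancel (+ 6) (λ ()) (cancel (N - + 2) N≢2 (begin
    (N - + 2) * (+ 6 * (+ 2 - Q))
      ≡⟨ second-difference N Q (c₁ N m) (c₀ N m) ⟨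
    p N m Q (N + N - + 1) - + 2 * p N m Q (N + N - + 2) + p N m Q (N + N - + 3)
      ≡⟨ cong₂ _+_ (cong₂ (λ s t → s - + 2 * t) (p-vanishes 1 (s≤s z≤n) (s≤s z≤n)) (p-vanishes 2 (s≤s z≤n) (s≤s (s≤s z≤n)))) (p-vanishes 3 (s≤s z≤n) (s≤s (s≤s (s≤s z≤n)))) ⟩
    0ℤ ∎))))
    where open ≡-Reasoning

  q≡2 : q ≡ 2
  q≡2 = +-injective Q≡2

  p₂-vanishes : ∀ j → 1 ≤ j → j ≤ 3 → p N m (+ 2) (N + N - + j) ≡ 0ℤ
  p₂-vanishes j 1≤j j≤3 = subst (λ Q → p N m Q (N + N - + j) ≡ 0ℤ) Q≡2 (p-vanishes j 1≤j j≤3)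

  3N≡2m²+4 : + 3 * N ≡ + 2 * (m * m) + + 4
  3N≡2m²+4 = i-j≡0⇒i≡j (+ 3 * N) (+ 2 * (m * m) + + 4) (cancel (+ 2) (λ ()) (trans (sym (first-difference N m))
    (cong₂ _-_ (p₂-vanishes 2 (s≤s z≤n) (s≤s (s≤s z≤n))) (p₂-vanishes 3 (s≤s z≤n) (s≤s (s≤s (s≤s z≤n)))))))

  p₂-value : p N m (+ 2) (N + N - + 0) ≡ + 6
  p₂-value = trans (lemma (p₂ 0) (p₂ 1) (p₂ 2) (p₂ 3) (p₂-vanishes 1 (s≤s z≤n) (s≤s z≤n)) (p₂-vanishes 2 (s≤s z≤n) (s≤s (s≤s z≤n))) (p₂-vanishes 3 (s≤s z≤n) (s≤s (s≤s (s≤s z≤n)))))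
    (third-difference N (c₁ N m) (c₀ N m))
    where
    p₂ : ℕ → ℤ
    p₂ j = p N m (+ 2) (N + N - + j)
    lemma : ∀ a b c d → b ≡ 0ℤ → c ≡ 0ℤ → d ≡ 0ℤ → a ≡ a - + 3 * b + + 3 * c - d
    lemma a b c d refl refl refl = unit a
      where
      unit : ∀ a → a ≡ a - + 3 * 0ℤ + + 3 * 0ℤ - 0ℤ
      unit = solve-∀

  sum-moment : ∀ x {k} (cs : Vec ℤ k) → k ≤ 8 → Q ^ k * ∑ ws (λ y → eval cs (agreement x y)) ≡ size * mean cs (N + N - + 0)
  sum-moment x {k} cs k≤8 = trans (cong (Q ^ k *_) (∑-cong ws (λ y → sym (*-identityˡ (eval cs (agreement x y))))))
    (trans (poly-moment x [] [] [] (λ ()) cs k≤8) (cong (λ s → size * mean cs (s - + 0)) n≡N+N))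

  N≢0 : N ≢ 0ℤ
  N≢0 e = ℕ.n≮0 (subst (4 ≤_) (+-injective e) 4≤ν)

  -- Without prescribed columns only `x₀` contributes to the sum of the quartic, through its value
  -- at agreement n. The mean is known from `p₂-value`.
  size-formula : + 8 * (N * (N * N - m * m)) ≡ + 3 * size
  size-formula = cancel₂ N N≢0 (cancel₂ (+ 8) (λ ()) (begin
    + 8 * (N * (+ 8 * (N * (N * N - m * m))))
      ≡⟨ lemma₁ N m ⟩
    + 32 * ((N + N) * (N + N - N) * ((N + N - N) * (N + N - N) - m * m))
      ≡⟨ cong (+ 32 *_) (quartic-eval N m (N + N)) ⟨
    + 32 * eval quarticPoly (N + N)
      ≡⟨ cong (λ s → + 32 * eval quarticPoly s) (trans (agreement-self x₀) n≡N+N) ⟨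
    + 32 * eval quarticPoly (agreement x₀ x₀)
      ≡⟨ cong (+ 32 *_) (trans (proj₂ single) (lemma₂ (eval quarticPoly (agreement x₀ x₀)) (proj₁ single))) ⟨
    + 32 * ∑ ws (λ y → eval quarticPoly (agreement x₀ y))
      ≡⟨ cong (λ s → s ^ 5 * ∑ ws (λ y → eval quarticPoly (agreement x₀ y))) Q≡2 ⟨
    Q ^ 5 * ∑ ws (λ y → eval quarticPoly (agreement x₀ y))
      ≡⟨ sum-moment x₀ quarticPoly (ℕ.m≤m+n 5 3) ⟩
    size * mean quarticPoly (N + N - + 0)
      ≡⟨ cong (size *_) (quartic-mean Q (c₂ N m) (c₁ N m) (c₀ N m) (N + N - + 0)) ⟩
    size * (Q * ((N + N - + 0) * p N m Q (N + N - + 0)))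
      ≡⟨ cong (λ Q → size * (Q * ((N + N - + 0) * p N m Q (N + N - + 0)))) Q≡2 ⟩
    size * (+ 2 * ((N + N - + 0) * p N m (+ 2) (N + N - + 0)))
      ≡⟨ cong (λ s → size * (+ 2 * ((N + N - + 0) * s))) p₂-value ⟩
    size * (+ 2 * ((N + N - + 0) * + 6))
      ≡⟨ lemma₃ size N ⟩
    + 8 * (N * (+ 3 * size)) ∎))
    where
    open ≡-Reasoning
    single = ∑-except 0ℤ ws (λ y → eval quarticPoly (agreement x₀ y)) (unique C) x₀∈ (λ y∈ ne → 0ℤ , quartic-vanishes y∈ (ne ∘ sym))
    lemma₁ : ∀ N m → + 8 * (N * (+ 8 * (N * (N * N - m * m)))) ≡ + 32 * ((N + N) * (N + N - N) * ((N + N - N) * (N + N - N) - m * m))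
    lemma₁ = solve-∀
    lemma₂ : ∀ e k → e + 0ℤ * k ≡ e
    lemma₂ = solve-∀
    lemma₃ : ∀ s N → s * (+ 2 * ((N + N - + 0) * + 6)) ≡ + 8 * (N * (+ 3 * s))
    lemma₃ = solve-∀

  cubicPoly : Vec ℤ 4
  cubicPoly = 1ℤ ∷ + 3 + m - + 2 * N ∷ (N - 1ℤ) * (N - 1ℤ - m) ∷ 0ℤ ∷ []

  cubic-value : ∀ {y} → y ∈ ws → x₀ ≢ y → ∃[ k ] eval cubicPoly (agreement x₀ y) ≡ (N + m) * (+ 2 * (m * m)) * k
  cubic-value {y} y∈ ne = let k , e = root (agreements x₀∈ y∈ ne) in k , trans (cubic-eval N m (agreement x₀ y)) e
    where
    root : ∀ {z} → z ≡ N + m ⊎ z ≡ N ⊎ z ≡ N - m ⊎ z ≡ 0ℤ → ∃[ k ] z * (z - N) * (z - N + m) ≡ (N + m) * (+ 2 * (m * m)) * k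
    root (inj₁ refl) = 1ℤ , lemma N m
      where
      lemma : ∀ N m → let z = N + m in z * (z - N) * (z - N + m) ≡ (N + m) * (+ 2 * (m * m)) * 1ℤ
      lemma = solve-∀
    root (inj₂ (inj₁ refl)) = 0ℤ , lemma N m
      where
      lemma : ∀ N m → let z = N in z * (z - N) * (z - N + m) ≡ (N + m) * (+ 2 * (m * m)) * 0ℤ
      lemma = solve-∀
    root (inj₂ (inj₂ (inj₁ refl))) = 0ℤ , lemma N m
      where
      lemma : ∀ N m → let z = N - m in z * (z - N) * (z - N + m) ≡ (N + m) * (+ 2 * (m * m)) * 0ℤ
      lemma = solve-∀
    root (inj₂ (inj₂ (inj₂ refl))) = 0ℤ , sym (*-zeroʳ ((N + m) * (+ 2 * (m * m))))

  N+m≢0 : N + m ≢ 0ℤ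
  N+m≢0 e = ⊥-elim (μ≢0 (ℕ.m+n≡0⇒n≡0 ν (+-injective (trans (pos-+ ν μ) e))))

  -- `B` is the number of codewords at distance `a` from `x₀`. Each contributes 2m²(N + m) to the
  -- sum of the cubic; besides them only `x₀` contributes. That `B` is an integer is what later
  -- restricts `μ`.
  cubic-formula : ∃[ B ] + 4 * (N * N) + + 4 * (m * m * B) ≡ size * N
  cubic-formula = B , cancel₂ (N + m) N+m≢0 (cancel₂ (+ 8) (λ ()) (begin
    + 8 * ((N + m) * (+ 4 * (N * N) + + 4 * (m * m * B)))
      ≡⟨ lemma₁ N m B ⟩
    + 16 * ((N + N) * (N + N - N) * (N + N - N + m) + (N + m) * (+ 2 * (m * m)) * B)
      ≡⟨ cong (λ s → + 16 * (s + (N + m) * (+ 2 * (m * m)) * B)) (cubic-eval N m (N + N)) ⟨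
    + 16 * (eval cubicPoly (N + N) + (N + m) * (+ 2 * (m * m)) * B)
      ≡⟨ cong (λ s → + 16 * (eval cubicPoly s + (N + m) * (+ 2 * (m * m)) * B)) (trans (agreement-self x₀) n≡N+N) ⟨
    + 16 * (eval cubicPoly (agreement x₀ x₀) + (N + m) * (+ 2 * (m * m)) * B)
      ≡⟨ cong (+ 16 *_) (proj₂ total) ⟨
    + 16 * ∑ ws (λ y → eval cubicPoly (agreement x₀ y))
      ≡⟨ cong (λ s → s ^ 4 * ∑ ws (λ y → eval cubicPoly (agreement x₀ y))) Q≡2 ⟨
    Q ^ 4 * ∑ ws (λ y → eval cubicPoly (agreement x₀ y))
      ≡⟨ sum-moment x₀ cubicPoly (ℕ.m≤m+n 4 4) ⟩
    size * mean cubicPoly (N + N - + 0)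
      ≡⟨ cong (size *_) mean-value ⟩
    size * (+ 8 * (N + m) * N)
      ≡⟨ lemma₂ size N m ⟩
    + 8 * ((N + m) * (size * N)) ∎))
    where
    open ≡-Reasoning
    total = ∑-except ((N + m) * (+ 2 * (m * m))) ws (λ y → eval cubicPoly (agreement x₀ y)) (unique C) x₀∈ (λ y∈ ne → cubic-value y∈ (ne ∘ sym))
    B = proj₁ total
    mean-value : mean cubicPoly (N + N - + 0) ≡ + 8 * (N + m) * N
    mean-value = trans (cong (λ Q → Q * (1ℤ * fall 3 M + Q * ((+ 3 + m - + 2 * N) * fall 2 M + Q * ((N - 1ℤ) * (N - 1ℤ - m) * fall 1 M + Q * (0ℤ * 1ℤ + 0ℤ))))) Q≡2)
      (cubic-mean N m)
      where M = N + N - + 0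
    lemma₁ : ∀ N m B → + 8 * ((N + m) * (+ 4 * (N * N) + + 4 * (m * m * B))) ≡ + 16 * ((N + N) * (N + N - N) * (N + N - N + m) + (N + m) * (+ 2 * (m * m)) * B)
    lemma₁ = solve-∀
    lemma₂ : ∀ s N m → s * (+ 8 * (N + m) * N) ≡ + 8 * ((N + m) * (s * N))
    lemma₂ = solve-∀

  μ²∣80 : μ ℕ.* μ ℕ.∣ 80
  μ²∣80 = divides (square-divides-80ℤ N m (proj₁ cubic-formula) size (proj₂ cubic-formula) size-formula 3N≡2m²+4)
    where
    divides : ∃[ X ] + 80 ≡ m * m * X → μ ℕ.* μ ℕ.∣ 80
    divides (X , e) = ℕ.divides ∣ X ∣ (trans (cong ∣_∣ e) (trans (abs-* (m * m) X)
      (trans (cong (ℕ._* ∣ X ∣) (abs-* m m)) (ℕ.*-comm (μ ℕ.* μ) ∣ X ∣))))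

  N-value : ∀ k c → μ ≡ k → + 2 * (+ k * + k) + + 4 ≡ + 3 * c → N ≡ c
  N-value k c e eq = cancel₂ (+ 3) {N} {c} (λ ()) (trans (trans 3N≡2m²+4 (cong (λ k → + 2 * (+ k * + k) + + 4) e)) eq)

  parameters : (ν ≡ 4 × μ ≡ 2) ⊎ (ν ≡ 12 × μ ≡ 4)
  parameters = cases (square-divides-80 μ μ≢0 μ²∣80)
    where
    cases : μ ≡ 1 ⊎ μ ≡ 2 ⊎ μ ≡ 4 → (ν ≡ 4 × μ ≡ 2) ⊎ (ν ≡ 12 × μ ≡ 4)
    -- For `μ` = 1 the relation gives ν = 2, that is n = 4.
    cases (inj₁ e)        = ⊥-elim (N≢2 (i≡j⇒i-j≡0 {N} {+ 2} (N-value 1 (+ 2) e refl)))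
    cases (inj₂ (inj₁ e)) = inj₁ (+-injective (N-value 2 (+ 4) e refl) , e)
    cases (inj₂ (inj₂ e)) = inj₂ (+-injective (N-value 4 (+ 12) e refl) , e)

-- Binary designs with the two possible sets of distances

dist≡wt : ∀ {n} (x y : Word n 2) → dist x y ≡ wt (x ⊞ y)
dist≡wt []             []             = refl
dist≡wt (zero ∷ x)     (zero ∷ y)     = dist≡wt x y
dist≡wt (zero ∷ x)     (suc zero ∷ y) = cong suc (dist≡wt x y)
dist≡wt (suc zero ∷ x) (zero ∷ y)     = cong suc (dist≡wt x y)
dist≡wt (suc zero ∷ x) (suc zero ∷ y) = dist≡wt x y

dist≤ : ∀ {n q} (x y : Word n q) → dist x y ≤ n
dist≤ []      []      = z≤n
dist≤ (a ∷ x) (b ∷ y) with a ≟ b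
... | yes _ = ℕ.m≤n⇒m≤1+n (dist≤ x y)
... | no  _ = s≤s (dist≤ x y)

dist≡0⇒≡ : ∀ {n q} (x y : Word n q) → dist x y ≡ 0 → x ≡ y
dist≡0⇒≡ []      []      _ = refl
dist≡0⇒≡ (a ∷ x) (b ∷ y) e with a ≟ b
... | yes refl = cong (a ∷_) (dist≡0⇒≡ x y e)

∣m+n∣n⇒∣m : ∀ {d} m {n} → d ℕ.∣ m ℕ.+ n → d ℕ.∣ n → d ℕ.∣ m
∣m+n∣n⇒∣m {d} m {n} d∣m+n = ℕ.∣m+n∣m⇒∣n (subst (d ℕ.∣_) (ℕ.+-comm m n) d∣m+n)

⊕-comm : ∀ a b → a ⊕ b ≡ b ⊕ a
⊕-comm zero       zero       = refl
⊕-comm zero       (suc zero) = refl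
⊕-comm (suc zero) zero       = refl
⊕-comm (suc zero) (suc zero) = refl

⊞-comm : ∀ {n} (x y : Word n 2) → x ⊞ y ≡ y ⊞ x
⊞-comm = zipWith-comm ⊕-comm

translate : ∀ {n} → Word n 2 → Fin n → Fin 2 ↔ Fin 2
translate x₀ j = mk↔ₛ′ (_⊕ lookup x₀ j) (_⊕ lookup x₀ j) inv inv
  where
  inv : ∀ b → (b ⊕ lookup x₀ j) ⊕ lookup x₀ j ≡ b
  inv b = trans (⊕-assoc b (lookup x₀ j) (lookup x₀ j)) (trans (cong (b ⊕_) (⊕-self (lookup x₀ j))) (⊕-identityʳ b))

isoMap-translate : ∀ {n} (σ : Fin n ↔ Fin n) (x₀ x : Word n 2) →
  isoMap σ (translate x₀ ∘ to σ) x ≡ rearrange (to σ) (x ⊞ x₀)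
isoMap-translate σ x₀ x = tabulate-cong λ j → sym (lookup-zipWith _⊕_ (to σ j) x x₀)

-- Adding `x₀` permutes the symbols in each coordinate. Position j of the image reads coordinate
-- `from τ j`, so the translation must be taken there.
translate-isomorphic : ∀ {n} (C : Code n 2) x₀ (D : Word n 2 → Set) (τ : Fin n ↔ Fin n) →
  (∀ y → (rearrange (to τ) y ⊞ x₀ ∈ words C) ⇔ D y) → IsomorphicTo C D
translate-isomorphic C x₀ D τ equiv = ↔-sym τ , (translate x₀ ∘ from τ) , λ x →
  let y = rearrange (from τ) (x ⊞ x₀)
      image : isoMap (↔-sym τ) (translate x₀ ∘ from τ) x ≡ y
      image = isoMap-translate (↔-sym τ) x₀ x
      back : rearrange (to τ) y ⊞ x₀ ≡ x
      back = trans (cong (_⊞ x₀) (rearrange-inverse (from τ) (to τ) (strictlyInverseʳ τ) (x ⊞ x₀))) (⊞-cancelʳ x x₀)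
  in mk⇔ (λ x∈ → subst D (sym image) (Equivalence.to (equiv y) (subst (_∈ words C) (sym back) x∈)))
         (λ d → subst (_∈ words C) back (Equivalence.from (equiv y) (subst D image d)))

module Detection {n q t : ℕ} (C : Code n q) (t≤n : t ≤ n) (design : IsDesign t C) where

  open Design C t t≤n design

  -- The sum of a polynomial of degree at most t in the agreements with `x` does not depend on `x`.
  -- Centred at `x₀` it equals the nonzero value at n; centred at a word outside the code satisfying
  -- `vanish` it would be zero.
  detect : ∀ {m} (cs : Vec ℤ m) → m ≤ suc t → Q ≢ 0ℤ → eval cs (+ n) ≢ 0ℤ →
    ∀ x₀ → x₀ ∈ ws → (∀ {y} → y ∈ ws → x₀ ≢ y → eval cs (agreement x₀ y) ≡ 0ℤ) →
    ∀ x → (∀ {y} → y ∈ ws → x ≢ y → eval cs (agreement x y) ≡ 0ℤ) → x ∈ ws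
  detect {m} cs m≤ Q≢0 value≢0 x₀ x₀∈ vanish₀ x vanish with DecMembership._∈?_ (≡-dec _≟_) x ws
  ... | yes x∈ = x∈
  ... | no x∉ = ⊥-elim (value≢0 (begin
    eval cs (+ n)                  ≡⟨ cong (eval cs) (agreement-self x₀) ⟨
    eval cs (agreement x₀ x₀)      ≡⟨ lemma (eval cs (agreement x₀ x₀)) (proj₁ except) ⟩
    1ℤ * eval cs (agreement x₀ x₀) + 0ℤ * proj₁ except  ≡⟨ proj₂ except ⟨
    total x₀                       ≡⟨ cancel₂ (Q ^ m) (Q≢0 ∘ i^n≡0⇒i≡0 Q m) (trans (center-free x₀) (sym (center-free x))) ⟩
    total x                        ≡⟨ ∑-zero ws (λ {y} y∈ → trans (*-identityˡ (eval cs (agreement x y))) (vanish y∈ λ { refl → x∉ y∈ })) ⟩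
    0ℤ                             ∎))
    where
    open ≡-Reasoning
    total : Word n q → ℤ
    total x = ∑ ws (λ y → 1ℤ * eval cs (agreement x y))
    center-free : ∀ x → Q ^ m * total x ≡ size * mean cs (+ n - + 0)
    center-free x = poly-moment x [] [] [] (λ ()) cs m≤
    except = ∑-except 0ℤ ws (λ y → 1ℤ * eval cs (agreement x₀ y)) (unique C) x₀∈
      (λ {y} y∈ ne → 0ℤ , trans (*-identityˡ (eval cs (agreement x₀ y))) (vanish₀ y∈ (ne ∘ sym)))
    lemma : ∀ e k → e ≡ 1ℤ * e + 0ℤ * k
    lemma = solve-∀

module _ {n : ℕ} (C : Code n 2) (8≤n : 8 ≤ n) (design : IsDesign 7 C) where

  open Design C 7 (ℕ.≤-trans (ℕ.m≤m+n 7 1) 8≤n) design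

  occurs : (is : Vec (Fin n) 7) → Unique (toList is) → ∀ u →
    ∃[ y ] (y ∈ words C × ∀ t → lookup y (lookup is t) ≡ lookup u t)
  occurs is un u with any? (λ y → all? (λ t → lookup y (lookup is t) ≟ lookup u t)) (words C)
  ... | yes found = find found
  ... | no none = ⊥-elim (length≢0 (proj₂ (proj₁ design)) (begin
    size                 ≡⟨ count-value is u un ℕ.≤-refl ⟨
    Q ^ 7 * count is u   ≡⟨ cong (Q ^ 7 *_) (∑-zero ws vanish) ⟩
    Q ^ 7 * 0ℤ           ≡⟨ *-zeroʳ (Q ^ 7) ⟩
    0ℤ                   ∎))
    where
    open ≡-Reasoning
    vanish : ∀ {y} → y ∈ ws → ind is u y ≡ 0ℤ
    vanish {y} y∈ with ind≡0⊎match is u y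
    ... | inj₁ z = z
    ... | inj₂ m = ⊥-elim (none (Any.map (λ { refl → m }) y∈))

-- Length 8: the even weight code.

evenWeight-unique : (C : Code 8 2) → IsDesign 7 C →
  (∀ {x y} → x ∈C C → y ∈C C → 2 ℕ.∣ dist x y) → IsomorphicTo C EvenWeight8
evenWeight-unique C design@((x₀ , x₀∈) , _) even =
  ↔-id _ , translate x₀ , λ x → mk⇔ (sound x) (complete x)
  where
  image : ∀ x → weight (isoMap (↔-id _) (translate x₀) x) ≡ wt (x ⊞ x₀)
  image x = trans (cong weight (trans (isoMap-translate (↔-id _) x₀ x) (tabulate∘lookup (x ⊞ x₀))))
    (trans (dist≡wt (x ⊞ x₀) 𝟎) (cong wt (⊞-identityʳ (x ⊞ x₀))))
  sound : ∀ x → x ∈C C → EvenWeight8 (isoMap (↔-id _) (translate x₀) x)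
  sound x x∈ = ℕ.n∣m⇒m%n≡0 _ 2 (subst (2 ℕ.∣_) (trans (dist≡wt x x₀) (sym (image x))) (even x∈ x₀∈))
  -- Different heads would give two weights differing by one, both even.
  same-head : ∀ b b' c k → 2 ℕ.∣ toℕ (b ⊕ c) ℕ.+ k → 2 ℕ.∣ toℕ (b' ⊕ c) ℕ.+ k → b ≡ b'
  same-head zero       zero       c          k d d' = refl
  same-head (suc zero) (suc zero) c          k d d' = refl
  same-head zero       (suc zero) zero       k d d' = ⊥-elim (from-no (2 ℕ.∣? 1) (∣m+n∣n⇒∣m 1 d' d))
  same-head zero       (suc zero) (suc zero) k d d' = ⊥-elim (from-no (2 ℕ.∣? 1) (∣m+n∣n⇒∣m 1 d d'))
  same-head (suc zero) zero       zero       k d d' = ⊥-elim (from-no (2 ℕ.∣? 1) (∣m+n∣n⇒∣m 1 d d'))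
  same-head (suc zero) zero       (suc zero) k d d' = ⊥-elim (from-no (2 ℕ.∣? 1) (∣m+n∣n⇒∣m 1 d' d))
  lastSeven : Vec (Fin 8) 7
  lastSeven = tabulate suc
  complete : ∀ x → EvenWeight8 (isoMap (↔-id _) (translate x₀) x) → x ∈C C
  complete (b ∷ x) e
    -- Strength 7 provides a codeword with the last seven entries of the given word; parity then
    -- determines the first entry.
    with b' ∷ y , y∈ , match ← occurs C ℕ.≤-refl design lastSeven (from-yes (unique? _≟_ (toList lastSeven))) x
    with refl ← trans (sym (tabulate∘lookup y)) (trans (tabulate-cong λ t → trans (cong (lookup (b' ∷ y)) (sym (lookup∘tabulate suc t))) (match t)) (tabulate∘lookup x))
    = subst (λ b → (b ∷ x) ∈C C) (sym (parity x₀ x₀∈ (ℕ.m%n≡0⇒n∣m _ 2 (trans (cong (_% 2) (sym (image (b ∷ x)))) e)))) y∈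
    where
    parity : ∀ x₀ → x₀ ∈C C → 2 ℕ.∣ wt ((b ∷ x) ⊞ x₀) → b ≡ b'
    parity (c ∷ s) s∈ d = same-head b b' c (wt (x ⊞ s)) d (subst (2 ℕ.∣_) (dist≡wt (b' ∷ x) (c ∷ s)) (even y∈ s∈))

-- Length 24: linearity and octads.

common : ∀ {n} → Word n 2 → Word n 2 → Word n 2 → ℕ
common []      []      []      = 0
common (a ∷ x) (b ∷ y) (c ∷ z) = toℕ a ℕ.* toℕ b ℕ.* toℕ c ℕ.+ common x y z

-- Inclusion and exclusion, checked bit by bit and written without subtraction. The triple
-- intersection has coefficient 4, so modulo 4 the weight of a sum of three words depends only on
-- the weights of the words and of their pairwise sums.
wt-⊞-⊞ : ∀ {n} (x y z : Word n 2) →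
  wt ((x ⊞ y) ⊞ z) ℕ.+ (wt x ℕ.+ wt y ℕ.+ wt z) ≡ wt (x ⊞ y) ℕ.+ wt (x ⊞ z) ℕ.+ wt (y ⊞ z) ℕ.+ common x y z ℕ.* 4
wt-⊞-⊞ []      []      []      = refl
wt-⊞-⊞ (a ∷ x) (b ∷ y) (c ∷ z) = begin
  (bit ((a ⊕ b) ⊕ c) ℕ.+ wt ((x ⊞ y) ⊞ z)) ℕ.+ ((bit a ℕ.+ wt x) ℕ.+ (bit b ℕ.+ wt y) ℕ.+ (bit c ℕ.+ wt z))
    ≡⟨ collect (bit ((a ⊕ b) ⊕ c)) (wt ((x ⊞ y) ⊞ z)) (bit a) (wt x) (bit b) (wt y) (bit c) (wt z) ⟩
  (bit ((a ⊕ b) ⊕ c) ℕ.+ (bit a ℕ.+ bit b ℕ.+ bit c)) ℕ.+ (wt ((x ⊞ y) ⊞ z) ℕ.+ (wt x ℕ.+ wt y ℕ.+ wt z))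
    ≡⟨ cong₂ ℕ._+_ (bits a b c) (wt-⊞-⊞ x y z) ⟩
  (bit (a ⊕ b) ℕ.+ bit (a ⊕ c) ℕ.+ bit (b ⊕ c) ℕ.+ bit a ℕ.* bit b ℕ.* bit c ℕ.* 4) ℕ.+ (wt (x ⊞ y) ℕ.+ wt (x ⊞ z) ℕ.+ wt (y ⊞ z) ℕ.+ common x y z ℕ.* 4)
    ≡⟨ spread (bit (a ⊕ b)) (bit (a ⊕ c)) (bit (b ⊕ c)) (bit a ℕ.* bit b ℕ.* bit c) (wt (x ⊞ y)) (wt (x ⊞ z)) (wt (y ⊞ z)) (common x y z) ⟩
  (bit (a ⊕ b) ℕ.+ wt (x ⊞ y)) ℕ.+ (bit (a ⊕ c) ℕ.+ wt (x ⊞ z)) ℕ.+ (bit (b ⊕ c) ℕ.+ wt (y ⊞ z)) ℕ.+ (bit a ℕ.* bit b ℕ.* bit c ℕ.+ common x y z) ℕ.* 4 ∎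
  where
  open ≡-Reasoning
  bit : Fin 2 → ℕ
  bit = toℕ
  bits : ∀ a b c → bit ((a ⊕ b) ⊕ c) ℕ.+ (bit a ℕ.+ bit b ℕ.+ bit c) ≡ bit (a ⊕ b) ℕ.+ bit (a ⊕ c) ℕ.+ bit (b ⊕ c) ℕ.+ bit a ℕ.* bit b ℕ.* bit c ℕ.* 4
  bits zero       zero       zero       = refl
  bits zero       zero       (suc zero) = refl
  bits zero       (suc zero) zero       = refl
  bits zero       (suc zero) (suc zero) = refl
  bits (suc zero) zero       zero       = refl
  bits (suc zero) zero       (suc zero) = refl
  bits (suc zero) (suc zero) zero       = refl
  bits (suc zero) (suc zero) (suc zero) = refl
  collect : ∀ d w a x b y c z → (d ℕ.+ w) ℕ.+ ((a ℕ.+ x) ℕ.+ (b ℕ.+ y) ℕ.+ (c ℕ.+ z)) ≡ (d ℕ.+ (a ℕ.+ b ℕ.+ c)) ℕ.+ (w ℕ.+ (x ℕ.+ y ℕ.+ z))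
  collect = ℕ-Solver.solve-∀
  spread : ∀ a b c d x y z k → (a ℕ.+ b ℕ.+ c ℕ.+ d ℕ.* 4) ℕ.+ (x ℕ.+ y ℕ.+ z ℕ.+ k ℕ.* 4) ≡ (a ℕ.+ x) ℕ.+ (b ℕ.+ y) ℕ.+ (c ℕ.+ z) ℕ.+ (d ℕ.+ k) ℕ.* 4
  spread = ℕ-Solver.solve-∀

support : ∀ {n} (p : Word n 2) → Vec (Fin n) (wt p)
support []             = []
support (zero ∷ p)     = Vec.map suc (support p)
support (suc zero ∷ p) = zero ∷ Vec.map suc (support p)

support-unique : ∀ {n} (p : Word n 2) → Unique (toList (support p))
support-unique []         = []
support-unique (zero ∷ p) = subst Unique (sym (toList-map suc (support p))) (map⁺ suc-injective (support-unique p))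
support-unique (suc zero ∷ p) =
  subst (All (zero ≢_)) (sym (toList-map suc (support p))) (All.map⁺ (All.universal (λ _ ()) _))
  ∷ subst Unique (sym (toList-map suc (support p))) (map⁺ suc-injective (support-unique p))

support-covers : ∀ {n} (p : Word n 2) j → lookup p j ≡ l → ∃[ t ] lookup (support p) t ≡ j
support-covers (suc zero ∷ p) zero    _ = zero , refl
support-covers (zero ∷ p)     (suc j) e = let t , e' = support-covers p j e in t , trans (lookup-map t suc (support p)) (cong suc e')
support-covers (suc zero ∷ p) (suc j) e = let t , e' = support-covers p j e in suc t , trans (lookup-map t suc (support p)) (cong suc e')

module Extended (C : Code 24 2) (design : IsDesign 7 C) (size≡4096 : length (words C) ≡ 4096)
  (degrees : ∀ {x y} → x ∈C C → y ∈C C → x ≢ y → dist x y ≡ 8 ⊎ dist x y ≡ 12 ⊎ dist x y ≡ 16 ⊎ dist x y ≡ 24) where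

  open Design C 7 (ℕ.m≤m+n 7 17) design

  x₀ : Word 24 2
  x₀ = proj₁ (proj₁ design)

  x₀∈ : x₀ ∈ ws
  x₀∈ = proj₂ (proj₁ design)

  dist-ok : ∀ {x y} → x ∈ ws → y ∈ ws → okWeight (dist x y) ≡ true
  dist-ok {x} {y} x∈ y∈ with ≡-dec _≟_ x y
  ... | yes refl = cong okWeight (dist-self x)
  ... | no x≢y with degrees x∈ y∈ x≢y
  ...   | inj₁ e               = cong okWeight e
  ...   | inj₂ (inj₁ e)        = cong okWeight e
  ...   | inj₂ (inj₂ (inj₁ e)) = cong okWeight e
  ...   | inj₂ (inj₂ (inj₂ e)) = cong okWeight e

  4∣dist : ∀ {x y} → x ∈ ws → y ∈ ws → 4 ℕ.∣ dist x y
  4∣dist {x} {y} x∈ y∈ with ≡-dec _≟_ x y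
  ... | yes refl = subst (4 ℕ.∣_) (sym (dist-self x)) (4 ℕ.∣0)
  ... | no x≢y with degrees x∈ y∈ x≢y
  ...   | inj₁ e               = subst (4 ℕ.∣_) (sym e) (ℕ.divides 2 refl)
  ...   | inj₂ (inj₁ e)        = subst (4 ℕ.∣_) (sym e) (ℕ.divides 3 refl)
  ...   | inj₂ (inj₂ (inj₁ e)) = subst (4 ℕ.∣_) (sym e) (ℕ.divides 4 refl)
  ...   | inj₂ (inj₂ (inj₂ e)) = subst (4 ℕ.∣_) (sym e) (ℕ.divides 6 refl)

  agreement≡ : ∀ x y {d} → dist x y ≡ d → agreement x y ≡ + 24 - + d
  agreement≡ x y refl = trans (lemma (+ dist x y) (agreement x y)) (cong (λ s → s - + dist x y) (dist+agreement x y))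
    where
    lemma : ∀ d z → z ≡ d + z - d
    lemma = solve-∀

  -- z (z - 4)(z - 8)(z - 12)(z - 16)(z - 20) in the basis of falling factorials.
  sextic : Vec ℤ 7
  sextic = + 1 ∷ - + 45 ∷ + 825 ∷ - + 7650 ∷ + 35595 ∷ - + 65835 ∷ + 0 ∷ []

  sextic-vanishes : ∀ x y → x ≢ y → 4 ℕ.∣ dist x y → eval sextic (agreement x y) ≡ 0ℤ
  sextic-vanishes x y x≢y (ℕ.divides k e) = trans (cong (eval sextic) (agreement≡ x y e)) (root k k≢0 k≤6)
    where
    k≢0 : k ≢ 0
    k≢0 refl = x≢y (dist≡0⇒≡ x y e)
    k≤6 : k ≤ 6
    k≤6 = ℕ.*-cancelʳ-≤ k 6 4 (subst (_≤ 24) e (dist≤ x y))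
    root : ∀ k → k ≢ 0 → k ≤ 6 → eval sextic (+ 24 - + (k ℕ.* 4)) ≡ 0ℤ
    root 0 ne _ = ⊥-elim (ne refl)
    root 1 _ _ = refl
    root 2 _ _ = refl
    root 3 _ _ = refl
    root 4 _ _ = refl
    root 5 _ _ = refl
    root 6 _ _ = refl
    root (suc (suc (suc (suc (suc (suc (suc k))))))) _ (s≤s (s≤s (s≤s (s≤s (s≤s (s≤s ()))))))

  -- A positive distance divisible by 4 leaves 0, 4, ..., 20 agreements, all roots of the sextic,
  -- which is nonzero at 24. Its degree 6 is within the strength.
  maximal : ∀ x → (∀ {y} → y ∈ ws → 4 ℕ.∣ dist x y) → x ∈ ws
  maximal x divisible = Detection.detect C (ℕ.m≤m+n 7 17) design sextic (ℕ.m≤m+n 7 1) (λ ()) (λ ())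
    x₀ x₀∈ (λ {y} y∈ ne → sextic-vanishes x₀ y ne (4∣dist x₀∈ y∈))
    x (λ {y} y∈ ne → sextic-vanishes x y ne (divisible y∈))

  P : Word 24 2 → Set
  P y = y ⊞ x₀ ∈ ws

  ∈⇒P : ∀ {y} → y ∈ ws → P (y ⊞ x₀)
  ∈⇒P {y} = subst (_∈ ws) (sym (⊞-cancelʳ y x₀))

  difference : ∀ x y → (x ⊞ x₀) ⊞ (y ⊞ x₀) ≡ x ⊞ y
  difference x y = begin
    (x ⊞ x₀) ⊞ (y ⊞ x₀)   ≡⟨ cong ((x ⊞ x₀) ⊞_) (⊞-comm y x₀) ⟩
    (x ⊞ x₀) ⊞ (x₀ ⊞ y)   ≡⟨ ⊞-assoc (x ⊞ x₀) x₀ y ⟨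
    ((x ⊞ x₀) ⊞ x₀) ⊞ y   ≡⟨ cong (_⊞ y) (⊞-cancelʳ x x₀) ⟩
    x ⊞ y                 ∎
    where open ≡-Reasoning

  dist-P : ∀ x y → dist (x ⊞ x₀) (y ⊞ x₀) ≡ wt (x ⊞ y)
  dist-P x y = trans (dist≡wt (x ⊞ x₀) (y ⊞ x₀)) (cong wt (difference x y))

  P-zero : P 𝟎
  P-zero = subst (_∈ ws) (sym (⊞-identityˡ x₀)) x₀∈

  4∣wt-⊞ : ∀ {x y} → P x → P y → 4 ℕ.∣ wt (x ⊞ y)
  4∣wt-⊞ {x} {y} px py = subst (4 ℕ.∣_) (dist-P x y) (4∣dist px py)

  4∣wt : ∀ {x} → P x → 4 ℕ.∣ wt x
  4∣wt {x} px = subst (4 ℕ.∣_) (cong wt (⊞-identityʳ x)) (4∣wt-⊞ {x} {𝟎} px P-zero)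

  -- By `maximal` it suffices that x + y + z has weight divisible by 4 for every z in the translate.
  -- This follows from `wt-⊞-⊞`, as single words and pairwise sums have such weights.
  P-closed : ∀ {x y} → P x → P y → P (x ⊞ y)
  P-closed {x} {y} px py = maximal ((x ⊞ y) ⊞ x₀) λ {c} c∈ →
    let z = c ⊞ x₀
        pz : P z
        pz = ∈⇒P c∈
    in subst (4 ℕ.∣_) (trans (sym (dist-P (x ⊞ y) z)) (cong (dist ((x ⊞ y) ⊞ x₀)) (⊞-cancelʳ c x₀)))
      (∣m+n∣n⇒∣m (wt ((x ⊞ y) ⊞ z))
        (subst (4 ℕ.∣_) (sym (wt-⊞-⊞ x y z))
          (ℕ.∣m∣n⇒∣m+n (ℕ.∣m∣n⇒∣m+n (ℕ.∣m∣n⇒∣m+n (4∣wt-⊞ {x} {y} px py) (4∣wt-⊞ {x} {z} px pz)) (4∣wt-⊞ {y} {z} py pz)) (ℕ.n∣m*n (common x y z))))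
        (ℕ.∣m∣n⇒∣m+n (ℕ.∣m∣n⇒∣m+n (4∣wt {x} px) (4∣wt {y} py)) (4∣wt {z} pz)))

  P-weights : ∀ {x} → P x → okWeight (wt x) ≡ true
  P-weights {x} px = subst (λ k → okWeight k ≡ true) (trans (dist-P x 𝟎) (cong wt (⊞-identityʳ x))) (dist-ok px P-zero)

  -- (z - 8)(z - 12) in the basis of falling factorials.
  quadratic : Vec ℤ 3
  quadratic = + 1 ∷ - + 19 ∷ + 96 ∷ []

  -- Consider the codewords differing from `x₀` at all five points. Without an octad their distances
  -- are 12, 16 and 24, where the quadratic takes the values 0, 0 and 96, so the sum is a multiple
  -- of 96. The moment gives 128 instead.
  P-octad : ∀ p → wt p ≡ 5 → ∃[ w ] (P w × wt w ≡ 8 × p ⊑ w)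
  P-octad p wp with any? (λ y → (dist y x₀ ℕ.≟ 8) ×-dec all? (λ j → (lookup p j ≟ l) →-dec (lookup (y ⊞ x₀) j ≟ l))) ws
  ... | yes found = let y , y∈ , d , above = find found in y ⊞ x₀ , ∈⇒P y∈ , trans (sym (dist≡wt y x₀)) d , above
  -- Both numbers carry the factor 2⁸ of the moment identity: 24576 = 256 · 96 and 32768 = 256 · 128
  -- = 4096 · 8.
  ... | no none = ⊥-elim (from-no (24576 ℕ.∣? 32768) (ℕ.divides ∣ k ∣ (begin
      32768                                                   ≡⟨ cong ∣_∣ total ⟨
      ∣ + 256 * ∑ ws f ∣                                      ≡⟨ cong (λ s → ∣ + 256 * s ∣) (proj₂ multiple) ⟩
      ∣ + 256 * (+ 96 * k) ∣                                  ≡⟨ abs-* (+ 256) (+ 96 * k) ⟩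
      256 ℕ.* ∣ + 96 * k ∣                                    ≡⟨ cong (256 ℕ.*_) (abs-* (+ 96) k) ⟩
      256 ℕ.* (96 ℕ.* ∣ k ∣)                                  ≡⟨ ℕ.*-assoc 256 96 ∣ k ∣ ⟨
      24576 ℕ.* ∣ k ∣                                         ≡⟨ ℕ.*-comm 24576 ∣ k ∣ ⟩
      ∣ k ∣ ℕ.* 24576                                         ∎)))
    where
    open ≡-Reasoning
    is = support p
    u : Vec (Fin 2) (wt p)
    -- The flipped symbols of `x₀`, so that adding `x₀` to a matching word gives ones on `p`.
    u = Vec.map (λ i → l ⊕ lookup x₀ i) is
    flip≢ : ∀ b → l ⊕ b ≢ b
    flip≢ zero ()
    flip≢ (suc zero) ()
    avoids : Avoids is u x₀
    avoids t e = flip≢ (lookup x₀ (lookup is t)) (trans (sym (lookup-map t (λ i → l ⊕ lookup x₀ i) is)) e)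
    f : Word 24 2 → ℤ
    f y = ind is u y * eval quadratic (agreement x₀ y)
    total : + 256 * ∑ ws f ≡ + 32768
    total = trans (subst (λ j → Q ^ (j ℕ.+ 3) * ∑ ws f ≡ size * mean quadratic (+ 24 - + j)) wp
                     (poly-moment x₀ is u (support-unique p) avoids quadratic (subst (λ j → j ℕ.+ 3 ≤ 8) (sym wp) ℕ.≤-refl)))
                  (cong (λ s → + s * mean quadratic (+ 19)) size≡4096)
    unflip : ∀ b → (l ⊕ b) ⊕ b ≡ l
    unflip zero       = refl
    unflip (suc zero) = refl
    matches⇒⊑ : ∀ y → (∀ t → lookup y (lookup is t) ≡ lookup u t) → p ⊑ y ⊞ x₀
    matches⇒⊑ y m j pj with support-covers p j pj
    ... | t , refl = trans (lookup-zipWith _⊕_ (lookup is t) y x₀)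
      (trans (cong (_⊕ lookup x₀ (lookup is t)) (trans (m t) (lookup-map t (λ i → l ⊕ lookup x₀ i) is))) (unflip (lookup x₀ (lookup is t))))
    term : ∀ {y} → y ∈ ws → ∃[ k ] f y ≡ + 96 * k
    term {y} y∈ with ind≡0⊎match is u y
    ... | inj₁ z = 0ℤ , trans (cong (_* eval quadratic (agreement x₀ y)) z) (*-zeroˡ (eval quadratic (agreement x₀ y)))
    ... | inj₂ m = by-degree (degrees x₀∈ y∈ x₀≢y)
      where
      x₀≢y : x₀ ≢ y
      x₀≢y refl = avoids (subst Fin (sym wp) zero) (sym (m (subst Fin (sym wp) zero)))
      at : ∀ {d} v → dist x₀ y ≡ d → eval quadratic (+ 24 - + d) ≡ + 96 * v → ∃[ k ] f y ≡ + 96 * k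
      at v e g = ind is u y * v , trans (cong (ind is u y *_) (trans (cong (eval quadratic) (agreement≡ x₀ y e)) g)) (lemma (ind is u y) v)
        where
        lemma : ∀ i v → i * (+ 96 * v) ≡ + 96 * (i * v)
        lemma = solve-∀
      by-degree : dist x₀ y ≡ 8 ⊎ dist x₀ y ≡ 12 ⊎ dist x₀ y ≡ 16 ⊎ dist x₀ y ≡ 24 → ∃[ k ] f y ≡ + 96 * k
      by-degree (inj₁ e) = ⊥-elim (none (Any.map (λ { refl → trans (dist-sym y) e , matches⇒⊑ y m }) y∈))
        where
        dist-sym : ∀ y → dist y x₀ ≡ dist x₀ y
        dist-sym y = trans (dist≡wt y x₀) (trans (cong wt (⊞-comm y x₀)) (sym (dist≡wt x₀ y)))
      by-degree (inj₂ (inj₁ e))        = at 0ℤ e refl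
      by-degree (inj₂ (inj₂ (inj₁ e))) = at 0ℤ e refl
      by-degree (inj₂ (inj₂ (inj₂ e))) = at 1ℤ e refl
    multiple = ∑-multiple (+ 96) ws f term
    k = proj₁ multiple

  golayLike : GolayLike P
  golayLike = record { zero∈ = P-zero ; closed = λ {x} {y} → P-closed {x} {y} ; weights = λ {x} → P-weights {x} ; octad = P-octad }

  golay-unique : IsomorphicTo C Golay24
  golay-unique = translate-isomorphic C x₀ Golay24 (proj₁ (GolayLike-unique golayLike)) (proj₂ (GolayLike-unique golayLike))

-- The parameters are variables tied by equations, so that matching on `refl` turns `C` into a
-- binary code of length 8 or 24.
classify : ∀ {n q ν a μ} (C : Code n q) → IsDesign 7 C → q ≡ 2 → n ≡ ν ℕ.+ ν → ν ≡ a ℕ.+ μ →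
  (ν ≡ 4 × μ ≡ 2) ⊎ (ν ≡ 12 × μ ≡ 4) →
  + 8 * (+ ν * (+ ν * + ν - + μ * + μ)) ≡ + 3 * + length (words C) →
  (∀ {x y} → x ∈C C → y ∈C C → x ≢ y → dist x y ≡ a ⊎ dist x y ≡ ν ⊎ dist x y ≡ n ∸ a ⊎ dist x y ≡ n) →
  IsomorphicTo C EvenWeight8 ⊎ IsomorphicTo C Golay24
classify {a = a} C design refl refl ν≡ (inj₁ (refl , refl)) _ degrees
  with refl ← ℕ.+-cancelʳ-≡ 2 2 a ν≡ = inj₁ (evenWeight-unique C design even)
  where
  even : ∀ {x y} → x ∈C C → y ∈C C → 2 ℕ.∣ dist x y
  even {x} {y} x∈ y∈ with ≡-dec _≟_ x y
  ... | yes refl = subst (2 ℕ.∣_) (sym (dist-self x)) (2 ℕ.∣0)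
  ... | no x≢y with degrees x∈ y∈ x≢y
  ...   | inj₁ e               = subst (2 ℕ.∣_) (sym e) (ℕ.divides 1 refl)
  ...   | inj₂ (inj₁ e)        = subst (2 ℕ.∣_) (sym e) (ℕ.divides 2 refl)
  ...   | inj₂ (inj₂ (inj₁ e)) = subst (2 ℕ.∣_) (sym e) (ℕ.divides 3 refl)
  ...   | inj₂ (inj₂ (inj₂ e)) = subst (2 ℕ.∣_) (sym e) (ℕ.divides 4 refl)
classify {a = a} C design refl refl ν≡ (inj₂ (refl , refl)) size≡ degrees
  with refl ← ℕ.+-cancelʳ-≡ 4 8 a ν≡ =
  -- Here 3|C| = 8 · 12 · (144 - 16), hence |C| = 4096.
  inj₂ (Extended.golay-unique C design (+-injective (cancel₂ (+ 3) (λ ()) (sym size≡))) degrees)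

theorem4p13 : (n q : ℕ) → n % 2 ≡ 0 → 8 ≤ n → 2 ≤ q →
    (C : Code n q) → IsDesign 7 C →
    (a : ℕ) → a < n / 2 →
    ((d : ℕ) → InDegreeSet C d ⇔ (d ≡ a ⊎ d ≡ n / 2 ⊎ d ≡ n ∸ a ⊎ d ≡ n)) →
    (a ≢ n / 2 × a ≢ n ∸ a × a ≢ n × n / 2 ≢ n ∸ a × n / 2 ≢ n × n ∸ a ≢ n) →
    IsomorphicTo C EvenWeight8 ⊎ IsomorphicTo C Golay24
theorem4p13 n q n-even 8≤n 2≤q C design a a<n/2 degreeSet _ =
  classify C design q≡2 n≡ν+ν ν≡a+μ parameters size-formula degrees
  where
  n≡ν+ν : n ≡ n / 2 ℕ.+ n / 2
  n≡ν+ν = trans (m≡m%n+[m/n]*n n 2) (trans (cong (ℕ._+ n / 2 ℕ.* 2) n-even) (trans (ℕ.*-comm (n / 2) 2) (cong (n / 2 ℕ.+_) (ℕ.+-identityʳ (n / 2)))))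
  ν≡a+μ : n / 2 ≡ a ℕ.+ (n / 2 ∸ a)
  ν≡a+μ = sym (ℕ.m+[n∸m]≡n (ℕ.<⇒≤ a<n/2))
  degrees : ∀ {x y} → x ∈C C → y ∈C C → x ≢ y → dist x y ≡ a ⊎ dist x y ≡ n / 2 ⊎ dist x y ≡ n ∸ a ⊎ dist x y ≡ n
  degrees {x} {y} x∈ y∈ x≢y = Equivalence.to (degreeSet (dist x y)) (x , y , x∈ , y∈ , x≢y , refl)
  open Parameters C 8≤n 2≤q design (n / 2) a (n / 2 ∸ a) n≡ν+ν ν≡a+μ (ℕ.m>n⇒m∸n≢0 a<n/2) degrees
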